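{- Let $m \geq 3$ and $n \geq 7$ be integers. Then $$\operatorname{rn}(P_m \Box W_n) = \begin{cases} \frac{1}{2}(m^2n+m^2+2m-2), & m \text{ even},\\ \frac{1}{2}(m^2n+m^2+2m+n-1), & m \text{ odd}.\end{cases}$$
   Context: $P_m$ is the path on vertices $u_1,\ldots,u_m$ with edges $u_iu_{i+1}$. The wheel $W_n$ is obtained from the cycle $C_n$ on $v_1,\ldots,v_n$ by adding a new vertex $v_0$ adjacent to all $v_i$. $G \Box H$ denotes the Cartesian product: vertex set $V(G)\times V(H)$, with $(g_1,h_1)$ adjacent to $(g_2,h_2)$ iff ($g_1=g_2$ and $h_1h_2\in E(H)$) or ($h_1=h_2$ and $g_1g_2 \in E(G)$). A radio labeling of a connected graph $G$ is a map $\varphi: V(G) \to \mathbb{N}\cup\{0\}$ with $|\varphi(u)-\varphi(v)| \geq \operatorname{diam}(G)+1-d(u,v)$ for all distinct $u,v$; its span is $\max|\varphi(u)-\varphi(v)|$; the radio number $\operatorname{rn}(G)$ is the minimum span over all radio labelings. -}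

module Defs where

open import Data.Nat using (ℕ; zero; suc; _+_; _≤_; _%_; ∣_-_∣)
open import Data.Fin using (Fin; toℕ) renaming (zero to fzero; suc to fsuc)
open import Data.Product using (Σ; ∃; ∃-syntax; _×_; _,_)
open import Data.Sum using (_⊎_)
open import Data.Empty using (⊥)
open import Data.Unit using (⊤)
open import Relation.Binary.PropositionalEquality using (_≡_)
open import Relation.Nullary using (¬_)

record Graph : Set₁ where
  field
    V   : Set
    Adj : V → V → Set
open Graph public

data Walk (G : Graph) : V G → V G → ℕ → Set where
  here : ∀ {u} → Walk G u u 0
  step : ∀ {u w v k} → Adj G u w → Walk G w v k → Walk G u v (suc k)

Dist : (G : Graph) → V G → V G → ℕ → Set
Dist G u v k = Walk G u v k × (∀ j → Walk G u v j → k ≤ j)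

IsDiam : (G : Graph) → ℕ → Set
IsDiam G D =
  (∀ u v → ∃[ k ] (Dist G u v k × k ≤ D)) × (∃[ u ] ∃[ v ] Dist G u v D)

IsRadioLabeling : (G : Graph) → (V G → ℕ) → Set
IsRadioLabeling G φ = Σ ℕ λ D → IsDiam G D ×
  (∀ u v → ¬ (u ≡ v) → ∀ k → Dist G u v k → D + 1 ≤ ∣ φ u - φ v ∣ + k)

IsSpan : (G : Graph) → (V G → ℕ) → ℕ → Set
IsSpan G φ s = (∀ u v → ∣ φ u - φ v ∣ ≤ s) × (∃[ u ] ∃[ v ] (∣ φ u - φ v ∣ ≡ s))

IsRadioNumber : Graph → ℕ → Set
IsRadioNumber G r =
  (∃[ φ ] (IsRadioLabeling G φ × IsSpan G φ r)) ×
  (∀ φ → IsRadioLabeling G φ → ∀ s → IsSpan G φ s → r ≤ s)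

-- Path P_m on vertices u_1..u_m, represented by Fin m (index i ↦ u_{i+1}).
Path : ℕ → Graph
Path m = record
  { V = Fin m
  ; Adj = λ i j → (suc (toℕ i) ≡ toℕ j) ⊎ (suc (toℕ j) ≡ toℕ i) }

CycleAdj : ℕ → ℕ → ℕ → Set
CycleAdj n a b = (suc a ≡ b) ⊎ (suc b ≡ a) ⊎
                 ((a ≡ 0) × (suc b ≡ n)) ⊎ ((b ≡ 0) × (suc a ≡ n))

-- Wheel W_n: vertex fzero is the hub v_0, fsuc i is the rim vertex v_{i+1};
-- rim vertices adjacent as in the cycle C_n.
WheelAdj : (n : ℕ) → Fin (suc n) → Fin (suc n) → Set
WheelAdj n fzero    fzero    = ⊥
WheelAdj n fzero    (fsuc j) = ⊤
WheelAdj n (fsuc i) fzero    = ⊤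
WheelAdj n (fsuc i) (fsuc j) = CycleAdj n (toℕ i) (toℕ j)

Wheel : ℕ → Graph
Wheel n = record { V = Fin (suc n) ; Adj = WheelAdj n }

_□_ : Graph → Graph → Graph
G □ H = record
  { V = V G × V H
  ; Adj = λ { (g₁ , h₁) (g₂ , h₂) →
      ((g₁ ≡ g₂) × Adj H h₁ h₂) ⊎ ((h₁ ≡ h₂) × Adj G g₁ g₂) } }

{-# OPTIONS --safe #-}

-- In P_m □ W_n the distance is |i − j| + d_W(h, h′), and it is at most w(u) + w(v) + c, where the weight
-- w adds the distance to the central row(s) and the distance to the hub, and c is 1 or 0 according as m
-- is even or odd.  Summing the radio condition along the vertices sorted by label therefore bounds the
-- span below by (mn + m − 1)(m + 2 − c) − 2 Σ w plus the weights of the two extreme vertices; for odd m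
-- these cannot both vanish.
-- The bound is attained by an order in which consecutive vertices lie on opposite sides of the centre
-- and at wheel distance spoke + spoke.  Rows are taken in pairs at distance ⌊m/2⌋ and visited
-- alternately; along the rim one follows 0, 2, 4, …, 1, 3, 5, …, shifted by 5 on one of the two rows, so
-- that for n ≥ 7 vertices visited shortly after one another are not adjacent.  For odd m the central and
-- the two outermost rows are visited cyclically first, with shifts 6, 0 and 2.
module Submission where

open import Defs
open import Data.Bool using (T)
open import Data.Empty using (⊥-elim)
open import Data.Fin using (Fin; toℕ; inject₁; fromℕ; fromℕ<) renaming (zero to fzero; suc to fsuc)
open import Data.Fin.Properties using (toℕ-injective; toℕ-inject₁; toℕ-fromℕ; toℕ-fromℕ<; toℕ<n)
open import Data.List using (List; _∷_; []; length; map; cartesianProduct; allFin; tabulate; _++_)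
open import Data.List.Properties using (map-++; map-∘; map-tabulate; length-tabulate; length-++; length-map)
open import Data.List.Membership.Propositional using (_∈_)
open import Data.List.Relation.Unary.All as All using (All)
open import Data.List.Relation.Unary.Any using (here; there)
open import Data.List.Relation.Unary.AllPairs as AllPairs using (AllPairs; _∷_; [])
open import Data.List.Relation.Unary.Linked using (Linked; _∷_; [-])
open import Data.List.Relation.Unary.Unique.Propositional using (Unique)
open import Data.List.Relation.Unary.Unique.Propositional.Properties using (cartesianProduct⁺; allFin⁺)
open import Data.List.Relation.Binary.Permutation.Propositional using (↭-sym; ↭⇒↭ₛ)
open import Data.List.Relation.Binary.Permutation.Propositional.Properties using (↭-length; map⁺)
import Data.List.Relation.Binary.Permutation.Setoid.Properties as PermSetoid
import Data.List.Sort as Sort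
open import Data.Nat using (ℕ; zero; suc; _+_; _*_; _∸_; _≤_; _<_; _≤ᵇ_; _/_; _%_; ∣_-_∣; z≤n; s≤s; NonZero; >-nonZero)
open import Data.Nat.DivMod using (m≡m%n+[m/n]*n; m%n<n; m*n/n≡m)
open import Data.Nat.ListAction using (sum)
open import Data.Nat.ListAction.Properties using (sum-++; sum-↭)
open import Data.Nat.Properties
open import Data.Nat.Tactic.RingSolver using (solve-∀)
open import Data.Product using (∃-syntax; _×_; _,_; proj₁; proj₂)
open import Data.Sum as Sum using (_⊎_; inj₁; inj₂; swap)
open import Data.Unit using (tt)
open import Relation.Binary.Definitions using (tri<; tri≈; tri>)
open import Relation.Binary.PropositionalEquality
import Relation.Binary.Construct.On as On
open import Relation.Nullary using (¬_; Dec; yes; no)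
open import Relation.Nullary.Decidable using (_⊎-dec_; _×-dec_)

-- Meeting the lower bound leaves no freedom in the labels: consecutive vertices must differ in
-- label by exactly diam + 1 minus their distance, and that distance must equal the sum of their
-- weights plus c. Only the order is free, and the danger lies in vertices two visits apart. In a
-- pair of rows at distance r the forced gap g between rim vertices is r for even m and r + 1 for
-- odd m, while diam + 1 = g + r + 2. Two visits give 2 g, so for even m two such vertices of one
-- row must again be nonadjacent. An odd number of rows cannot be split into pairs. The centre and
-- the two outermost rows have levels 0, r, r and mutual distances equal to the sums of these, so a
-- cycle through them is still tight, and its three gaps add up to exactly diam + 1. The ends of the
-- order are hubs: those of the two central rows for even m, both of weight 0; that of the central
-- row and that of a row next to it for odd m, of weights 0 and 1.

-- The inequality a ≤ b as a nonnegative combination of hypotheses: l ≤ r is their sum, s the slack, and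
-- what remains is a semiring identity.
linear : ∀ {a b l r} s → l ≤ r → a + r + s ≡ b + l → a ≤ b
linear {a} {b} {l} {r} s l≤r eq = +-cancelʳ-≤ l a b (begin
  a + l      ≤⟨ +-monoʳ-≤ a l≤r ⟩
  a + r      ≤⟨ m≤m+n (a + r) s ⟩
  a + r + s  ≡⟨ eq ⟩
  b + l      ∎)
  where open ≤-Reasoning

infixl 6 _⊹_
_⊹_ : ∀ {a b c d} → a ≤ b → c ≤ d → a + c ≤ b + d
_⊹_ = +-mono-≤

infixl 7 _⊛_
_⊛_ : ∀ {a b} c → a ≤ b → c * a ≤ c * b
c ⊛ p = *-monoʳ-≤ c p

impossible : ∀ {ℓ} {A : Set ℓ} {l r} s → l ≤ r → 1 + r + s ≡ 0 + l → A
impossible {l = l} {r} s l≤r eq with linear {1} {0} s l≤r eq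
... | ()

swap₃ : ∀ a b c → a + b + c ≡ a + c + b
swap₃ = solve-∀

-- Distances and diameter

IsMetric : (G : Graph) → (V G → V G → ℕ) → Set
IsMetric G d = ∀ u v → Dist G u v (d u v)

Dist-unique : ∀ {G u v k l} → Dist G u v k → Dist G u v l → k ≡ l
Dist-unique (p , p-min) (q , q-min) = ≤-antisym (p-min _ q) (q-min _ p)

IsDiam-≤ : ∀ {G D D′} → IsDiam G D → IsDiam G D′ → D ≤ D′
IsDiam-≤ (_ , u , v , D-dist) (bound , _) with bound u v
... | k , k-dist , k≤D′ = ≤-trans (≤-reflexive (Dist-unique D-dist k-dist)) k≤D′

IsDiam-intro : ∀ {G d D} → IsMetric G d → (∀ u v → d u v ≤ D) → ∀ u v → d u v ≡ D → IsDiam G D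
IsDiam-intro metric bound u v attained =
  (λ x y → _ , metric x y , bound x y) , u , v , subst (Dist _ u v) attained (metric u v)

-- A radio labeling carries its own diameter `D′`; comparing it with the computed one makes the
-- condition usable.
radio⁻ : ∀ {G d D φ} → IsMetric G d → IsDiam G D → IsRadioLabeling G φ →
         ∀ u v → ¬ u ≡ v → D + 1 ≤ ∣ φ u - φ v ∣ + d u v
radio⁻ metric diam (D′ , diam′ , sep) u v u≢v =
  ≤-trans (+-monoˡ-≤ 1 (IsDiam-≤ diam diam′)) (sep u v u≢v _ (metric u v))

radio⁺ : ∀ {G d D φ} → IsMetric G d → IsDiam G D →
         (∀ u v → ¬ u ≡ v → D + 1 ≤ ∣ φ u - φ v ∣ + d u v) → IsRadioLabeling G φ
radio⁺ {φ = φ} metric diam sep = _ , diam , λ u v u≢v k k-dist →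
  subst (λ l → _ ≤ ∣ φ u - φ v ∣ + l) (Dist-unique (metric u v) k-dist) (sep u v u≢v)

Walk-□ : ∀ {G H g g′ h h′ k l} → Walk G g g′ k → Walk H h h′ l → Walk (G □ H) (g , h) (g′ , h′) (k + l)
Walk-□ here here = here
Walk-□ here (step a q) = step (inj₁ (refl , a)) (Walk-□ here q)
Walk-□ (step a p) q = step (inj₂ (refl , a)) (Walk-□ p q)

-- Each edge of the product moves in one factor only, so the edges can be sorted into two walks.
Walk-□⁻ : ∀ {G H g g′ h h′ k} → Walk (G □ H) (g , h) (g′ , h′) k →
          ∃[ a ] ∃[ b ] (Walk G g g′ a × Walk H h h′ b × a + b ≡ k)
Walk-□⁻ here = 0 , 0 , here , here , refl
Walk-□⁻ (step (inj₁ (refl , e)) w) with Walk-□⁻ w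
... | a , b , p , q , eq = a , suc b , p , step e q , trans (+-suc a b) (cong suc eq)
Walk-□⁻ (step (inj₂ (refl , e)) w) with Walk-□⁻ w
... | a , b , p , q , eq = suc a , b , step e p , q , cong suc eq

Dist-□ : ∀ {G H g g′ h h′ k l} → Dist G g g′ k → Dist H h h′ l → Dist (G □ H) (g , h) (g′ , h′) (k + l)
Dist-□ {G} {H} (p , p-min) (q , q-min) = Walk-□ p q , minimal
  where
  minimal : ∀ j → Walk (G □ H) _ _ j → _ ≤ j
  minimal j w with Walk-□⁻ w
  ... | a , b , p′ , q′ , refl = +-mono-≤ (p-min a p′) (q-min b q′)

-- Every function d that vanishes on the diagonal and drops by at most one along an edge is a lower
-- bound for the length of walks.
Walk-length : ∀ {G} (d : V G → V G → ℕ) → (∀ v → d v v ≡ 0) →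
              (∀ {u w} v → Adj G u w → d u v ≤ suc (d w v)) →
              ∀ {u v k} → Walk G u v k → d u v ≤ k
Walk-length d d-refl d-step {u} here = ≤-reflexive (d-refl u)
Walk-length d d-refl d-step {v = v} (step a w) = ≤-trans (d-step v a) (s≤s (Walk-length d d-refl d-step w))

path-up : ∀ {m} k (i j : Fin m) → toℕ i + k ≡ toℕ j → Walk (Path m) i j k
path-up zero i j eq with toℕ-injective {i = i} {j} (trans (sym (+-identityʳ _)) eq)
... | refl = here
path-up {m} (suc k) i j eq = step (inj₁ (sym i′≡)) (path-up k i′ j (trans (cong (_+ k) i′≡) (trans (sym (+-suc (toℕ i) k)) eq)))
  where
  1+i<m : suc (toℕ i) < m
  1+i<m = <-≤-trans (s≤s (linear k ≤-refl (lemma (toℕ i) (toℕ j) eq))) (toℕ<n j)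
    where
    lemma : ∀ a b → a + suc k ≡ b → suc a + 0 + k ≡ b + 0
    lemma a b refl = rearrange a k
      where
      rearrange : ∀ a k → suc a + 0 + k ≡ a + suc k + 0
      rearrange = solve-∀
  i′ = fromℕ< 1+i<m
  i′≡ : toℕ i′ ≡ suc (toℕ i)
  i′≡ = toℕ-fromℕ< 1+i<m

path-down : ∀ {m} k (i j : Fin m) → toℕ j + k ≡ toℕ i → Walk (Path m) i j k
path-down zero i j eq with toℕ-injective {i = j} {i} (trans (sym (+-identityʳ _)) eq)
... | refl = here
path-down (suc k) fzero j eq = ⊥-elim (1+n≢0 (trans (sym (+-suc (toℕ j) k)) eq))
path-down (suc k) (fsuc i) j eq =
  step (inj₂ (cong suc (toℕ-inject₁ i)))
       (path-down k (inject₁ i) j (trans (suc-injective (trans (sym (+-suc (toℕ j) k)) eq)) (sym (toℕ-inject₁ i))))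

pathDist : ∀ {m} → Fin m → Fin m → ℕ
pathDist i j = ∣ toℕ i - toℕ j ∣

pathDist-step : ∀ {m} {i i′ : Fin m} j → Adj (Path m) i i′ → pathDist i j ≤ suc (pathDist i′ j)
pathDist-step {i = i} {i′} j a = ≤-trans (∣-∣-triangle (toℕ i) (toℕ i′) (toℕ j)) (+-monoˡ-≤ _ (adjacent a))
  where
  adjacent : Adj (Path _) i i′ → ∣ toℕ i - toℕ i′ ∣ ≤ 1
  adjacent (inj₁ eq) rewrite sym eq | +-comm 1 (toℕ i) = ≤-reflexive (∣m-m+n∣≡n (toℕ i) 1)
  adjacent (inj₂ eq) rewrite sym eq | ∣-∣-comm (suc (toℕ i′)) (toℕ i′) | +-comm 1 (toℕ i′) = ≤-reflexive (∣m-m+n∣≡n (toℕ i′) 1)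

path-metric : ∀ m → IsMetric (Path m) pathDist
path-metric m i j = walk , λ k → Walk-length pathDist (λ v → ∣n-n∣≡0 (toℕ v)) pathDist-step
  where
  walk : Walk (Path m) i j (pathDist i j)
  walk with ≤-total (toℕ i) (toℕ j)
  ... | inj₁ i≤j = path-up _ i j (trans (cong (toℕ i +_) (m≤n⇒∣m-n∣≡n∸m i≤j)) (m+[n∸m]≡n i≤j))
  ... | inj₂ j≤i = path-down _ i j (trans (cong (toℕ j +_) (m≤n⇒∣n-m∣≡n∸m j≤i)) (m+[n∸m]≡n j≤i))

cycleAdj? : ∀ n a b → Dec (CycleAdj n a b)
cycleAdj? n a b = (suc a ≟ b) ⊎-dec (suc b ≟ a) ⊎-dec ((a ≟ 0) ×-dec (suc b ≟ n)) ⊎-dec ((b ≟ 0) ×-dec (suc a ≟ n))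

CycleAdj-sym : ∀ {n a b} → CycleAdj n a b → CycleAdj n b a
CycleAdj-sym (inj₁ e) = inj₂ (inj₁ e)
CycleAdj-sym (inj₂ (inj₁ e)) = inj₁ e
CycleAdj-sym (inj₂ (inj₂ e)) = inj₂ (inj₂ (swap e))

-- Distance in the wheel, not along the cycle: the detour through the hub caps it at 2.
rimDist : ℕ → ℕ → ℕ → ℕ
rimDist n a b with a ≟ b | cycleAdj? n a b
... | yes _ | _     = 0
... | no _  | yes _ = 1
... | no _  | no _  = 2

rimDist-refl : ∀ n a → rimDist n a a ≡ 0
rimDist-refl n a with a ≟ a
... | yes _   = refl
... | no a≢a = ⊥-elim (a≢a refl)

rimDist≤2 : ∀ n a b → rimDist n a b ≤ 2
rimDist≤2 n a b with a ≟ b | cycleAdj? n a b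
... | yes _ | _     = z≤n
... | no _  | yes _ = s≤s z≤n
... | no _  | no _  = ≤-refl

rimDist-distinct : ∀ {n a b} → ¬ a ≡ b → 1 ≤ rimDist n a b
rimDist-distinct {n} {a} {b} a≢b with a ≟ b | cycleAdj? n a b
... | yes e | _     = ⊥-elim (a≢b e)
... | no _  | yes _ = s≤s z≤n
... | no _  | no _  = s≤s z≤n

rimDist-far : ∀ {n a b} → ¬ a ≡ b → ¬ CycleAdj n a b → rimDist n a b ≡ 2
rimDist-far {n} {a} {b} a≢b a≁b with a ≟ b | cycleAdj? n a b
... | yes e | _     = ⊥-elim (a≢b e)
... | no _  | yes e = ⊥-elim (a≁b e)
... | no _  | no _  = refl

rimDist-sym : ∀ n a b → rimDist n a b ≡ rimDist n b a
rimDist-sym n a b with a ≟ b | cycleAdj? n a b | b ≟ a | cycleAdj? n b a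
... | yes _ | _     | yes _ | _     = refl
... | yes e | _     | no b≢a | _     = ⊥-elim (b≢a (sym e))
... | no a≢b | _     | yes e | _     = ⊥-elim (a≢b (sym e))
... | no _  | yes _ | no _  | yes _ = refl
... | no _  | yes e | no _  | no b≁a = ⊥-elim (b≁a (CycleAdj-sym e))
... | no _  | no a≁b | no _  | yes e = ⊥-elim (a≁b (CycleAdj-sym e))
... | no _  | no _  | no _  | no _  = refl

-- The left side is at most 2, so only `b ≡ c` could break the bound, and then `a` is adjacent to
-- `c`.
rimDist-step : ∀ {n a b} c → CycleAdj n a b → rimDist n a c ≤ suc (rimDist n b c)
rimDist-step {n} {a} {b} c a~b with a ≟ c | cycleAdj? n a c
... | yes _ | _      = z≤n
... | no _  | yes _  = s≤s z≤n
... | no _  | no a≁c = s≤s (rimDist-distinct {n} λ { refl → a≁c a~b })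

wheelDist : ∀ {n} → Fin (suc n) → Fin (suc n) → ℕ
wheelDist fzero fzero = 0
wheelDist fzero (fsuc j) = 1
wheelDist (fsuc i) fzero = 1
wheelDist {n} (fsuc i) (fsuc j) = rimDist n (toℕ i) (toℕ j)

wheelDist-refl : ∀ {n} (h : Fin (suc n)) → wheelDist h h ≡ 0
wheelDist-refl fzero = refl
wheelDist-refl {n} (fsuc i) = rimDist-refl n (toℕ i)

wheelDist-sym : ∀ {n} (h h′ : Fin (suc n)) → wheelDist h h′ ≡ wheelDist h′ h
wheelDist-sym fzero fzero = refl
wheelDist-sym fzero (fsuc j) = refl
wheelDist-sym (fsuc i) fzero = refl
wheelDist-sym {n} (fsuc i) (fsuc j) = rimDist-sym n (toℕ i) (toℕ j)

wheelDist-step : ∀ {n} {h h′ : Fin (suc n)} h″ → Adj (Wheel n) h h′ → wheelDist h h″ ≤ suc (wheelDist h′ h″)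
wheelDist-step {h = fzero} fzero a = z≤n
wheelDist-step {h = fzero} (fsuc k) a = s≤s z≤n
wheelDist-step {h = fsuc i} fzero a = s≤s z≤n
wheelDist-step {n} {h = fsuc i} {fzero} (fsuc k) a = rimDist≤2 n (toℕ i) (toℕ k)
wheelDist-step {h = fsuc i} {fsuc j} (fsuc k) a = rimDist-step (toℕ k) a

wheel-metric : ∀ n → IsMetric (Wheel n) wheelDist
wheel-metric n h h′ = walk h h′ , λ k → Walk-length wheelDist wheelDist-refl wheelDist-step
  where
  walk : ∀ h h′ → Walk (Wheel n) h h′ (wheelDist h h′)
  walk fzero fzero = here
  walk fzero (fsuc j) = step tt here
  walk (fsuc i) fzero = step tt here
  walk (fsuc i) (fsuc j) with toℕ i ≟ toℕ j | cycleAdj? n (toℕ i) (toℕ j)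
  ... | yes e | _ with toℕ-injective {i = i} {j} e
  ...   | refl = here
  walk (fsuc i) (fsuc j) | no _ | yes a = step a here
  walk (fsuc i) (fsuc j) | no _ | no _  = step {w = fzero} tt (step tt here)

spoke : ∀ {n} → Fin (suc n) → ℕ
spoke fzero = 0
spoke (fsuc _) = 1

wheelDist≤spokes : ∀ {n} (h h′ : Fin (suc n)) → wheelDist h h′ ≤ spoke h + spoke h′
wheelDist≤spokes fzero fzero = z≤n
wheelDist≤spokes fzero (fsuc j) = ≤-refl
wheelDist≤spokes (fsuc i) fzero = ≤-refl
wheelDist≤spokes {n} (fsuc i) (fsuc j) = rimDist≤2 n (toℕ i) (toℕ j)

wheelDist≤2 : ∀ {n} (h h′ : Fin (suc n)) → wheelDist h h′ ≤ 2
wheelDist≤2 h h′ = ≤-trans (wheelDist≤spokes h h′) (+-mono-≤ (spoke≤1 h) (spoke≤1 h′))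
  where
  spoke≤1 : ∀ {n} (h : Fin (suc n)) → spoke h ≤ 1
  spoke≤1 fzero = z≤n
  spoke≤1 (fsuc _) = ≤-refl

gridDist : ∀ {m n} → V (Path m □ Wheel n) → V (Path m □ Wheel n) → ℕ
gridDist (i , h) (j , h′) = pathDist i j + wheelDist h h′

grid-metric : ∀ m n → IsMetric (Path m □ Wheel n) gridDist
grid-metric m n (i , h) (j , h′) = Dist-□ (path-metric m i j) (wheel-metric n h h′)

grid-diam : ∀ m n → 4 ≤ n → IsDiam (Path (suc m) □ Wheel n) (m + 2)
grid-diam m n@(suc (suc (suc (suc _)))) (s≤s (s≤s (s≤s (s≤s _)))) = IsDiam-intro (grid-metric (suc m) n) bound
  -- Rim positions 0 and 2 in the two outermost rows; they are nonadjacent once the rim has four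
  -- vertices.
  (fzero , fsuc fzero) (fromℕ m , fsuc (fsuc (fsuc fzero)))
  (cong₂ _+_ (toℕ-fromℕ m) (rimDist-far {n} {0} {2} (λ ())
    λ { (inj₁ ()) ; (inj₂ (inj₁ ())) ; (inj₂ (inj₂ (inj₁ (_ , ())))) ; (inj₂ (inj₂ (inj₂ (() , _)))) }))
  where
  bound : ∀ u v → gridDist {suc m} {n} u v ≤ m + 2
  bound (i , h) (j , h′) =
    +-mono-≤ (≤-trans (∣m-n∣≤m⊔n (toℕ i) (toℕ j)) (⊔-lub (≤-pred (toℕ<n i)) (≤-pred (toℕ<n j)))) (wheelDist≤2 h h′)

-- The lower bound

module _ {A : Set} (φ w : A → ℕ) (s : ℕ) where

  Separated : A → A → Set
  Separated x y = (¬ x ≡ y) × s ≤ ∣ φ x - φ y ∣ + (w x + w y)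

  Separated-sym : ∀ {x y} → Separated x y → Separated y x
  Separated-sym {x} {y} (x≢y , sep) =
    (λ y≡x → x≢y (sym y≡x)) , subst (s ≤_) (cong₂ _+_ (∣-∣-comm (φ x) (φ y)) (+-comm (w x) (w y))) sep

  -- Each gap is at least `s` minus the weights of its two ends, so inner weights are subtracted
  -- twice and those of `x` and `z` once. That the ends are distinct is recorded for odd m, where it
  -- makes their weights positive in sum.
  separated-chain : ∀ x xs → AllPairs Separated (x ∷ xs) → Linked (λ y z → φ y ≤ φ z) (x ∷ xs) →
    ∃[ z ] (z ∈ x ∷ xs × (1 ≤ length xs → ¬ x ≡ z) ×
            φ x ≤ φ z × φ x + length xs * s + (w x + w z) ≤ φ z + 2 * sum (map w (x ∷ xs)))
  separated-chain x [] _ _ = x , here refl , (λ ()) , ≤-refl , ≤-reflexive (lemma (φ x) (w x))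
    where
    lemma : ∀ p a → p + 0 + (a + a) ≡ p + 2 * (a + 0)
    lemma = solve-∀
  separated-chain x (y ∷ ys) (sep ∷ seps) (x≤y ∷ sorted) with separated-chain y ys seps sorted
  ... | z , z∈ , _ , y≤z , ih = z , there z∈ , (λ _ → proj₁ (All.lookup sep z∈)) , ≤-trans x≤y y≤z
      , linear 0 (ih ⊹ gap) (lemma (φ x) (φ y) (φ z) (w x) (w y) (w z) s (length ys * s) (sum (map w ys)))
    where
    gap : s + φ x ≤ φ y + (w x + w y)
    gap = begin
      s + φ x                                    ≤⟨ +-monoˡ-≤ (φ x) (proj₂ (All.head sep)) ⟩
      ∣ φ x - φ y ∣ + (w x + w y) + φ x          ≡⟨ cong (λ d → d + (w x + w y) + φ x) (m≤n⇒∣m-n∣≡n∸m x≤y) ⟩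
      φ y ∸ φ x + (w x + w y) + φ x              ≡⟨ swap₃ (φ y ∸ φ x) (w x + w y) (φ x) ⟩
      φ y ∸ φ x + φ x + (w x + w y)              ≡⟨ cong (_+ (w x + w y)) (m∸n+n≡m x≤y) ⟩
      φ y + (w x + w y)                          ∎
      where
      open ≤-Reasoning
    lemma : ∀ φx φy φz x y z s l t →
            (φx + (s + l) + (x + z)) + (φz + 2 * (y + t) + (φy + (x + y))) + 0
            ≡ (φz + 2 * (x + (y + t))) + (φy + l + (y + z) + (s + φx))
    lemma = solve-∀

  -- Telescoping along the elements sorted by φ: every element but the first and the last one pays its
  -- weight twice.
  spread : ∀ xs l → length xs ≡ suc (suc l) → Unique xs →
           (∀ x y → ¬ x ≡ y → s ≤ ∣ φ x - φ y ∣ + (w x + w y)) →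
           ∃[ u ] ∃[ v ] ((¬ u ≡ v) × suc l * s + (w u + w v) ≤ ∣ φ u - φ v ∣ + 2 * sum (map w xs))
  spread xs l len unique sep = extract (sort xs) (trans (↭-length (sort-↭ xs)) len)
      (PermSetoid.AllPairs-resp-↭ (setoid A) Separated-sym (resp₂ Separated) (↭⇒↭ₛ (↭-sym (sort-↭ xs)))
        (AllPairs.map (λ {x} {y} x≢y → x≢y , sep x y x≢y) unique))
      (sort-↗ xs) (sum-↭ (map⁺ w (sort-↭ xs)))
    where
    open Sort (On.decTotalOrder ≤-decTotalOrder φ) using (sort; sort-↭; sort-↗)
    extract : ∀ ys → length ys ≡ suc (suc l) → AllPairs Separated ys → Linked (λ y z → φ y ≤ φ z) ys →
              sum (map w ys) ≡ sum (map w xs) →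
              ∃[ u ] ∃[ v ] ((¬ u ≡ v) × suc l * s + (w u + w v) ≤ ∣ φ u - φ v ∣ + 2 * sum (map w xs))
    extract (x ∷ ys) len seps sorted total with separated-chain x ys seps sorted
    ... | z , _ , x≢z , x≤z , bound rewrite suc-injective len | sym total =
      x , z , x≢z (s≤s z≤n) , linear 0 (bound ⊹ m≤n+∣n-m∣ (φ z) (φ x))
            (lemma (φ x) (φ z) ∣ φ x - φ z ∣ (suc l * s) (w x + w z) (2 * sum (map w (x ∷ ys))))
      where
      lemma : ∀ φx φz d l w t → l + w + (φz + t + (φx + d)) + 0 ≡ d + t + (φx + l + w + φz)
      lemma = solve-∀

-- The total weight of the vertices

sum-cartesianProduct : ∀ {A B : Set} (f : A → ℕ) (g : B → ℕ) xs ys →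
  sum (map (λ (x , y) → f x + g y) (cartesianProduct xs ys)) ≡ length ys * sum (map f xs) + length xs * sum (map g ys)
sum-cartesianProduct f g [] ys = sym (trans (+-identityʳ _) (*-zeroʳ (length ys)))
sum-cartesianProduct f g (x ∷ xs) ys = begin
  sum (map h (map (x ,_) ys ++ cartesianProduct xs ys))
    ≡⟨ cong sum (map-++ h (map (x ,_) ys) _) ⟩
  sum (map h (map (x ,_) ys) ++ map h (cartesianProduct xs ys))
    ≡⟨ sum-++ (map h (map (x ,_) ys)) _ ⟩
  sum (map h (map (x ,_) ys)) + sum (map h (cartesianProduct xs ys))
    ≡⟨ cong₂ _+_ (trans (cong sum (sym (map-∘ ys))) (row ys)) (sum-cartesianProduct f g xs ys) ⟩
  length ys * f x + sum (map g ys) + (length ys * sum (map f xs) + length xs * sum (map g ys))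
    ≡⟨ lemma (length ys) (length xs) (f x) (sum (map f xs)) (sum (map g ys)) ⟩
  length ys * (f x + sum (map f xs)) + (sum (map g ys) + length xs * sum (map g ys)) ∎
  where
  open ≡-Reasoning
  h = λ (p : _ × _) → f (proj₁ p) + g (proj₂ p)
  row : ∀ ys → sum (map (λ y → f x + g y) ys) ≡ length ys * f x + sum (map g ys)
  row [] = refl
  row (y ∷ ys) = trans (cong (f x + g y +_) (row ys)) (shuffle (f x) (g y) (length ys) (sum (map g ys)))
    where
    shuffle : ∀ a b l t → a + b + (l * a + t) ≡ a + l * a + (b + t)
    shuffle = solve-∀
  lemma : ∀ l k a t u → l * a + u + (l * t + k * u) ≡ l * (a + t) + (u + k * u)
  lemma = solve-∀

length-cartesianProduct : ∀ {A B : Set} (xs : List A) (ys : List B) → length (cartesianProduct xs ys) ≡ length xs * length ys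
length-cartesianProduct [] ys = refl
length-cartesianProduct (x ∷ xs) ys =
  trans (length-++ (map (x ,_) ys)) (cong₂ _+_ (length-map (x ,_) ys) (length-cartesianProduct xs ys))

sumBelow : ℕ → (ℕ → ℕ) → ℕ
sumBelow m f = sum (tabulate {n = m} (λ i → f (toℕ i)))

sumBelow-+ : ∀ m f g → sumBelow m (λ i → f i + g i) ≡ sumBelow m f + sumBelow m g
sumBelow-+ zero f g = refl
sumBelow-+ (suc m) f g = trans (cong (f 0 + g 0 +_) (sumBelow-+ m (λ i → f (suc i)) (λ i → g (suc i))))
                               (lemma (f 0) (g 0) _ _)
  where
  lemma : ∀ a b c d → a + b + (c + d) ≡ a + c + (b + d)
  lemma = solve-∀

sumBelow-const : ∀ m c → sumBelow m (λ _ → c) ≡ m * c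
sumBelow-const zero c = refl
sumBelow-const (suc m) c = cong (c +_) (sumBelow-const m c)

-- Gauss's sum of c, ..., c + e - 1, doubled and with the negative term `e` moved to the left. The
-- induction peels off the first term, so `c` has to vary.
sumBelow-arithmetic : ∀ e c → 2 * sumBelow e (λ i → i + c) + e ≡ 2 * (e * c) + e * e
sumBelow-arithmetic zero c = refl
sumBelow-arithmetic (suc e) c = trans (cong (λ t → 2 * (c + t) + suc e) shift)
  (trans (lemma₁ c e (sumBelow e (λ i → i + suc c))) (trans (cong (λ t → 2 * c + t + 1) (sumBelow-arithmetic e (suc c))) (lemma₂ e c)))
  where
  shift : sumBelow e (λ i → suc i + c) ≡ sumBelow e (λ i → i + suc c)
  shift = trans (sumBelow-+ e suc (λ _ → c)) (trans (cong₂ _+_ (sumBelow-+ e (λ _ → 1) (λ i → i)) (sumBelow-const e c))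
    (trans (cong (λ t → t + sumBelow e (λ i → i) + e * c) (sumBelow-const e 1)) (trans (lemma e c (sumBelow e (λ i → i)))
      (trans (cong (sumBelow e (λ i → i) +_) (sym (sumBelow-const e (suc c)))) (sym (sumBelow-+ e (λ i → i) (λ _ → suc c)))))))
    where
    lemma : ∀ e c t → e * 1 + t + e * c ≡ t + e * suc c
    lemma = solve-∀
  lemma₁ : ∀ c e t → 2 * (c + t) + suc e ≡ 2 * c + (2 * t + e) + 1
  lemma₁ = solve-∀
  lemma₂ : ∀ e c → 2 * c + (2 * (e * suc c) + e * e) + 1 ≡ 2 * (suc e * c) + suc e * suc e
  lemma₂ = solve-∀

-- The first `a` terms are truncated to 0, which leaves 0 + 1 + ... + (e - 1).
sumBelow-above : ∀ a e → 2 * sumBelow (a + e) (_∸ a) + e ≡ e * e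
sumBelow-above zero e = begin
  2 * sumBelow e (λ i → i) + e                          ≡⟨ lemma (sumBelow e (λ i → i)) e ⟩
  2 * (sumBelow e (λ i → i) + e * 0) + e                ≡⟨ cong (λ t → 2 * (sumBelow e (λ i → i) + t) + e) (sumBelow-const e 0) ⟨
  2 * (sumBelow e (λ i → i) + sumBelow e (λ _ → 0)) + e ≡⟨ cong (λ t → 2 * t + e) (sumBelow-+ e (λ i → i) (λ _ → 0)) ⟨
  2 * sumBelow e (λ i → i + 0) + e                      ≡⟨ sumBelow-arithmetic e 0 ⟩
  2 * (e * 0) + e * e                                   ≡⟨ cong (λ t → 2 * t + e * e) (*-zeroʳ e) ⟩
  e * e                                                 ∎
  where
  open ≡-Reasoning
  lemma : ∀ t e → 2 * t + e ≡ 2 * (t + e * 0) + e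
  lemma = solve-∀
sumBelow-above (suc a) e = sumBelow-above a e

sumBelow-below : ∀ b e → 2 * sumBelow (b + e) (b ∸_) ≡ b * b + b
sumBelow-below zero zero = refl
sumBelow-below zero (suc e) = cong (2 *_) (trans (sumBelow-const e 0) (*-zeroʳ e))
sumBelow-below (suc b) e = trans (*-distribˡ-+ 2 (suc b) (sumBelow (b + e) (b ∸_)))
  (trans (cong (2 * suc b +_) (sumBelow-below b e)) (lemma b))
  where
  lemma : ∀ b → 2 * suc b + (b * b + b) ≡ suc b * suc b + suc b
  lemma = solve-∀

-- Distance of a row from the centre {b, …, a} of the path.
level : ℕ → ℕ → ℕ → ℕ
level a b i = (i ∸ a) + (b ∸ i)

-- `e` counts the rows from the central row `c + b` upwards, itself included: they contribute e (e -
-- 1) / 2, and the `b` rows below the centre b (b + 1) / 2.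
level-sum : ∀ c b e → 2 * sumBelow (c + b + e) (level (c + b) b) + e ≡ e * e + (b * b + b)
level-sum c b e = begin
  2 * sumBelow (c + b + e) (level (c + b) b) + e
    ≡⟨ cong (λ t → 2 * t + e) (sumBelow-+ (c + b + e) (_∸ (c + b)) (b ∸_)) ⟩
  2 * (sumBelow (c + b + e) (_∸ (c + b)) + sumBelow (c + b + e) (b ∸_)) + e
    ≡⟨ lemma e (sumBelow (c + b + e) (_∸ (c + b))) _ ⟩
  (2 * sumBelow (c + b + e) (_∸ (c + b)) + e) + 2 * sumBelow (c + b + e) (b ∸_)
    ≡⟨ cong₂ _+_ (sumBelow-above (c + b) e) (trans (cong (λ m → 2 * sumBelow m (b ∸_)) (rotate c b e)) (sumBelow-below b (c + e))) ⟩
  e * e + (b * b + b) ∎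
  where
  open ≡-Reasoning
  lemma : ∀ e t u → 2 * (t + u) + e ≡ (2 * t + e) + 2 * u
  lemma = solve-∀
  rotate : ∀ c b e → c + b + e ≡ b + (c + e)
  rotate = solve-∀

-- For i ≤ j add j ≤ c + b + (j ∸ (c + b)) and b ≤ i + (b ∸ i), then cancel b.
level-dist : ∀ c b i j → ∣ i - j ∣ ≤ level (c + b) b i + level (c + b) b j + c
level-dist c b i j with ≤-total i j
... | inj₁ i≤j = ≤-trans (≤-reflexive (m≤n⇒∣m-n∣≡n∸m i≤j)) (ordered i j)
  where
  ordered : ∀ i j → j ∸ i ≤ level (c + b) b i + level (c + b) b j + c
  ordered i j = m≤n+o⇒m∸n≤o j i (linear (i ∸ (c + b) + (b ∸ j)) (m≤n+m∸n j (c + b) ⊹ m≤n+m∸n b i)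
    (lemma i j b c (i ∸ (c + b)) (b ∸ i) (j ∸ (c + b)) (b ∸ j)))
    where
    lemma : ∀ i j b c p q r s → j + (c + b + r + (i + q)) + (p + s) ≡ i + (p + q + (r + s) + c) + (j + b)
    lemma = solve-∀
... | inj₂ j≤i = ≤-trans (≤-reflexive (m≤n⇒∣n-m∣≡n∸m j≤i))
  (m≤n+o⇒m∸n≤o i j (linear (j ∸ (c + b) + (b ∸ i)) (m≤n+m∸n i (c + b) ⊹ m≤n+m∸n b j)
    (lemma i j b c (i ∸ (c + b)) (b ∸ i) (j ∸ (c + b)) (b ∸ j))))
  where
  lemma : ∀ i j b c p q r s → i + (c + b + p + (j + s)) + (r + q) ≡ j + (p + q + (r + s) + c) + (i + b)
  lemma = solve-∀

vertices : ∀ m n → List (Fin m × Fin (suc n))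
vertices m n = cartesianProduct (allFin m) (allFin (suc n))

weight : ∀ {m n} → ℕ → ℕ → Fin m × Fin (suc n) → ℕ
weight a b (i , h) = level a b (toℕ i) + spoke h

weight-sum : ∀ m n a b → sum (map (weight a b) (vertices m n)) ≡ suc n * sumBelow m (level a b) + m * n
weight-sum m n a b = trans (sum-cartesianProduct (λ i → level a b (toℕ i)) spoke (allFin m) (allFin (suc n)))
  (cong₂ _+_ (cong₂ _*_ (length-tabulate {n = suc n} (λ i → i)) (cong sum (map-tabulate {n = m} (λ i → i) (λ i → level a b (toℕ i)))))
             (cong₂ _*_ (length-tabulate {n = m} (λ i → i))
               (trans (cong sum (map-tabulate {n = suc n} (λ i → i) spoke)) (trans (sumBelow-const n 1) (*-identityʳ n)))))

-- The rows {b, …, c + b} are central, and s + c = diam + 1.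
grid-spread : ∀ m n c b e s l φ → 4 ≤ n → suc m ≡ c + b + e → s + c ≡ m + 3 → suc m * suc n ≡ suc (suc l) →
  IsRadioLabeling (Path (suc m) □ Wheel n) φ →
  ∃[ u ] ∃[ v ] ((¬ u ≡ v) × suc l * s + (weight (c + b) b u + weight (c + b) b v) + suc n * e
                      ≤ ∣ φ u - φ v ∣ + (suc n * (e * e + (b * b + b)) + 2 * (suc m * n)))
grid-spread m n c b e s l φ 4≤n m≡ s≡ N≡ radio
  with spread φ w s (vertices (suc m) n) l
         (trans (length-cartesianProduct (allFin (suc m)) (allFin (suc n)))
           (trans (cong₂ _*_ (length-tabulate {n = suc m} (λ i → i)) (length-tabulate {n = suc n} (λ i → i))) N≡))
         (cartesianProduct⁺ (allFin⁺ (suc m)) (allFin⁺ (suc n))) separated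
  where
  w = weight (c + b) b
  separated : ∀ u v → ¬ u ≡ v → s ≤ ∣ φ u - φ v ∣ + (w u + w v)
  separated u@(i , h) v@(j , h′) u≢v =
    linear 0 (radio⁻ {φ = φ} (grid-metric (suc m) n) (grid-diam m n 4≤n) radio u v u≢v
              ⊹ level-dist c b (toℕ i) (toℕ j) ⊹ wheelDist≤spokes h h′)
      (lemma ∣ φ u - φ v ∣ (pathDist i j) (wheelDist h h′) (level (c + b) b (toℕ i)) (level (c + b) b (toℕ j)) (spoke h) (spoke h′) s≡)
    where
    lemma : ∀ d p q x y t t′ → s + c ≡ m + 3 →
            s + (d + (p + q) + (x + y + c) + (t + t′)) + 0 ≡ d + (x + t + (y + t′)) + (m + 2 + 1 + p + q)
    lemma d p q x y t t′ eq = trans (lhs d p q x y t t′ s c) (trans (cong (d + p + q + x + y + t + t′ +_) eq) (rhs d p q x y t t′ m))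
      where
      lhs : ∀ d p q x y t t′ s c → s + (d + (p + q) + (x + y + c) + (t + t′)) + 0
                ≡ d + p + q + x + y + t + t′ + (s + c)
      lhs = solve-∀
      rhs : ∀ d p q x y t t′ m → d + p + q + x + y + t + t′ + (m + 3) ≡ d + (x + t + (y + t′)) + (m + 2 + 1 + p + q)
      rhs = solve-∀
... | u , v , u≢v , bound = u , v , u≢v , (begin
  suc l * s + (w u + w v) + suc n * e
    ≤⟨ +-monoˡ-≤ (suc n * e) bound ⟩
  ∣ φ u - φ v ∣ + 2 * sum (map w (vertices (suc m) n)) + suc n * e
    ≡⟨ cong (λ t → ∣ φ u - φ v ∣ + 2 * t + suc n * e) (weight-sum (suc m) n (c + b) b) ⟩
  ∣ φ u - φ v ∣ + 2 * (suc n * sumBelow (suc m) (level (c + b) b) + suc m * n) + suc n * e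
    ≡⟨ lemma ∣ φ u - φ v ∣ (suc n) (sumBelow (suc m) (level (c + b) b)) (suc m * n) e ⟩
  ∣ φ u - φ v ∣ + (suc n * (2 * sumBelow (suc m) (level (c + b) b) + e) + 2 * (suc m * n))
    ≡⟨ cong (λ t → ∣ φ u - φ v ∣ + (suc n * t + 2 * (suc m * n)))
         (trans (cong (λ m → 2 * sumBelow m (level (c + b) b) + e) m≡) (level-sum c b e)) ⟩
  ∣ φ u - φ v ∣ + (suc n * (e * e + (b * b + b)) + 2 * (suc m * n)) ∎)
  where
  open ≤-Reasoning
  w = weight (c + b) b
  lemma : ∀ d n t r e → d + 2 * (n * t + r) + n * e ≡ d + (n * (2 * t + e) + 2 * r)
  lemma = solve-∀

-- With a single central row, its hub is the only vertex of weight 0; this is what costs odd m an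
-- extra 1.
weight≡0 : ∀ {m n} b (u : Fin m × Fin (suc n)) → weight b b u ≡ 0 → toℕ (proj₁ u) ≡ b × proj₂ u ≡ fzero
weight≡0 b (i , fzero) w≡0 = ≤-antisym (m∸n≡0⇒m≤n (m+n≡0⇒m≡0 _ w≡0′)) (m∸n≡0⇒m≤n (m+n≡0⇒n≡0 (toℕ i ∸ b) w≡0′)) , refl
  where w≡0′ = m+n≡0⇒m≡0 (level b b (toℕ i)) w≡0
weight≡0 b (i , fsuc h) w≡0 with m+n≡0⇒n≡0 (level b b (toℕ i)) w≡0
... | ()

weights-positive : ∀ {m n} b (u v : Fin m × Fin (suc n)) → ¬ u ≡ v → 1 ≤ weight b b u + weight b b v
weights-positive b u v u≢v with weight b b u in eqᵤ | weight b b v in eqᵥ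
... | suc _ | _     = s≤s z≤n
... | zero  | suc _ = s≤s z≤n
... | zero  | zero with weight≡0 b u eqᵤ | weight≡0 b v eqᵥ
...   | i≡b , h≡0 | j≡b , h′≡0 =
  ⊥-elim (u≢v (cong₂ _,_ (toℕ-injective (trans i≡b (sym j≡b))) (trans h≡0 (sym h′≡0))))

spread-even : ∀ k n φ → 4 ≤ n → IsRadioLabeling (Path (2 * suc k) □ Wheel n) φ →
              ∃[ u ] ∃[ v ] (2 * (suc n * (suc k * suc k)) + 2 * k + 1 ≤ ∣ φ u - φ v ∣)
spread-even k n φ 4≤n radio =
  -- The centre consists of the rows `k` and `k + 1`, and `l + 1` is the number of gaps. The two end
  -- weights are given away as slack.
  let u , v , _ , bound = grid-spread (k + suc (k + 0)) n 1 k (suc k) (2 * k + 3) (2 * (suc k * n) + 2 * k) φ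
                                  4≤n (lemma₁ k) (lemma₂ k) (lemma₃ k n) radio
  in u , v , linear (weight (suc k) k u + weight (suc k) k v) bound
    (lemma k n ∣ φ u - φ v ∣ (weight (suc k) k u + weight (suc k) k v))
  where
  lemma₁ : ∀ k → suc (k + suc (k + 0)) ≡ 1 + k + suc k
  lemma₁ = solve-∀
  lemma₂ : ∀ k → 2 * k + 3 + 1 ≡ k + suc (k + 0) + 3
  lemma₂ = solve-∀
  lemma₃ : ∀ k n → suc (k + suc (k + 0)) * suc n ≡ suc (suc (2 * (suc k * n) + 2 * k))
  lemma₃ = solve-∀
  lemma : ∀ k n d w →
    2 * (suc n * (suc k * suc k)) + 2 * k + 1 + (d + (suc n * (suc k * suc k + (k * k + k)) + 2 * (suc (k + suc (k + 0)) * n))) + w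
    ≡ d + (suc (2 * (suc k * n) + 2 * k) * (2 * k + 3) + w + suc n * suc k)
  lemma = solve-∀

spread-odd : ∀ k n φ → 4 ≤ n → IsRadioLabeling (Path (1 + 2 * suc k) □ Wheel n) φ →
             ∃[ u ] ∃[ v ] (2 * (suc n * (suc k * suc k)) + 2 * (suc k * n) + n + 4 * suc k + 1 ≤ ∣ φ u - φ v ∣)
spread-odd k n φ 4≤n radio =
  -- The only central row is `k + 1`. Here the end weights are kept, and `weights-positive` raises
  -- the bound by 1.
  let u , v , u≢v , bound = grid-spread (2 * suc k) n 0 (suc k) (suc (suc k)) (2 * k + 5) (2 * (suc k * n) + n + 2 * k + 1) φ
                                  4≤n (lemma₁ k) (lemma₂ k) (lemma₃ k n) radio
  in u , v , linear 0 (bound ⊹ weights-positive (suc k) u v u≢v)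
    (lemma k n ∣ φ u - φ v ∣ (weight (suc k) (suc k) u + weight (suc k) (suc k) v))
  where
  lemma₁ : ∀ k → suc (2 * suc k) ≡ suc k + suc (suc k)
  lemma₁ = solve-∀
  lemma₂ : ∀ k → 2 * k + 5 + 0 ≡ 2 * suc k + 3
  lemma₂ = solve-∀
  lemma₃ : ∀ k n → suc (2 * suc k) * suc n ≡ suc (suc (2 * (suc k * n) + n + 2 * k + 1))
  lemma₃ = solve-∀
  lemma : ∀ k n d w →
    2 * (suc n * (suc k * suc k)) + 2 * (suc k * n) + n + 4 * suc k + 1
      + (d + (suc n * (suc (suc k) * suc (suc k) + (suc k * suc k + suc k)) + 2 * (suc (2 * suc k) * n)) + w) + 0
    ≡ d + (suc (2 * (suc k * n) + n + 2 * k + 1) * (2 * k + 5) + w + suc n * suc (suc k) + 1)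
  lemma = solve-∀

-- Traversing the rim

-- Multiples of `n` are added on both sides, so that neither signs nor truncated subtraction occur.
Congruent : ℕ → ℕ → ℕ → Set
Congruent n x y = ∃[ a ] ∃[ b ] (x + a * n ≡ y + b * n)

Congruent-sym : ∀ {n x y} → Congruent n x y → Congruent n y x
Congruent-sym (a , b , eq) = b , a , sym eq

Congruent-trans : ∀ {n x y z} → Congruent n x y → Congruent n y z → Congruent n x z
Congruent-trans {n} {x} {y} {z} (a , b , eq) (c , d , eq′) = a + c , d + b , (begin
  x + (a + c) * n        ≡⟨ lemma x a c n ⟩
  (x + a * n) + c * n    ≡⟨ cong (_+ c * n) eq ⟩
  (y + b * n) + c * n    ≡⟨ swap₃ y (b * n) (c * n) ⟩
  (y + c * n) + b * n    ≡⟨ cong (_+ b * n) eq′ ⟩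
  (z + d * n) + b * n    ≡⟨ lemma z d b n ⟨
  z + (d + b) * n        ∎)
  where
  open ≡-Reasoning
  lemma : ∀ x a c n → x + (a + c) * n ≡ (x + a * n) + c * n
  lemma = solve-∀

Congruent-+ : ∀ {n x y} c → Congruent n x y → Congruent n (x + c) (y + c)
Congruent-+ {n} {x} {y} c (a , b , eq) = a , b , trans (swap₃ x c (a * n)) (trans (cong (_+ c) eq) (swap₃ y (b * n) c))

Congruent-cancel : ∀ {n x y} c → Congruent n (c + x) (c + y) → Congruent n x y
Congruent-cancel {n} {x} {y} c (a , b , eq) = a , b , +-cancelˡ-≡ c _ _ (trans (sym (+-assoc c x (a * n))) (trans eq (+-assoc c y (b * n))))

-- Strip copies of `n` from both sides together; if one side runs out first, the other is too large.
Congruent⇒≡ : ∀ {n x y} → x < n → y < n → Congruent n x y → x ≡ y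
Congruent⇒≡ {n} {x} {y} x<n y<n (a , b , eq) = go a b eq
  where
  overflow : ∀ {x y} c → x < n → x + 0 ≡ y + (n + c) → x ≡ y
  overflow {x} {y} c x<n eq = impossible (y + c) (x<n ⊹ ≤-reflexive (sym eq)) (lemma x y n c)
    where
    lemma : ∀ x y n c → 1 + (n + (x + 0)) + (y + c) ≡ 0 + (suc x + (y + (n + c)))
    lemma = solve-∀
  go : ∀ a b → x + a * n ≡ y + b * n → x ≡ y
  go zero zero eq = trans (sym (+-identityʳ x)) (trans eq (+-identityʳ y))
  go zero (suc b) eq = overflow (b * n) x<n eq
  go (suc a) zero eq = sym (overflow (a * n) y<n (sym eq))
  go (suc a) (suc b) eq = go a b (+-cancelˡ-≡ n _ _ (trans (lemma x n (a * n)) (trans eq (sym (lemma y n (b * n))))))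
    where
    lemma : ∀ x n t → n + (x + t) ≡ x + (n + t)
    lemma = solve-∀

CycleAdj⇒Congruent : ∀ {n x y} → CycleAdj n x y → Congruent n (x + 1) y ⊎ Congruent n (y + 1) x
CycleAdj⇒Congruent {n} {x} {y} (inj₁ refl) = inj₁ (0 , 0 , cong (_+ 0) (+-comm x 1))
CycleAdj⇒Congruent {n} {x} {y} (inj₂ (inj₁ refl)) = inj₂ (0 , 0 , cong (_+ 0) (+-comm y 1))
CycleAdj⇒Congruent {n} {x} {y} (inj₂ (inj₂ (inj₁ (refl , refl)))) = inj₂ (0 , 1 , cong (_+ 0) (+-comm y 1))
CycleAdj⇒Congruent {n} {x} {y} (inj₂ (inj₂ (inj₂ (refl , refl)))) = inj₁ (0 , 1 , cong (_+ 0) (+-comm x 1))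

module _ {n : ℕ} where

  cancel-shift : ∀ {x y} δ c → Congruent n (x + (δ + c)) (y + c) → Congruent n (x + δ) y
  cancel-shift {x} {y} δ c e = Congruent-cancel c (subst₂ (Congruent n) (lemma x δ c) (+-comm y c) e)
    where
    lemma : ∀ x δ c → x + (δ + c) ≡ c + (x + δ)
    lemma = solve-∀

  shifted-distinct : ∀ {x y} δ → Congruent n (x + δ) y → 1 ≤ δ → δ < n → ¬ x ≡ y
  shifted-distinct {x} {y} δ e 1≤δ δ<n refl
    with Congruent⇒≡ {n} {δ} {0} δ<n (≤-<-trans z≤n δ<n) (Congruent-cancel x (subst (Congruent n (x + δ)) (sym (+-identityʳ x)) e))
  shifted-distinct _ _ () _ refl | refl

  -- An edge would force δ ≡ 1 or δ + 1 ≡ 0 modulo n, and both are excluded by 2 ≤ δ and δ + 1 < n.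
  shifted-apart : ∀ {x y} δ → Congruent n (x + δ) y → 2 ≤ δ → δ + 2 ≤ n → rimDist n x y ≡ 2
  shifted-apart {x} {y} δ e 2≤δ δ+2≤n = rimDist-far (shifted-distinct δ e (<⇒≤ 2≤δ) δ<n) nonadjacent
    where
    δ+1<n : δ + 1 < n
    δ+1<n = linear 0 δ+2≤n (lemma δ n)
      where
      lemma : ∀ δ n → suc (δ + 1) + n + 0 ≡ n + (δ + 2)
      lemma = solve-∀
    δ<n : δ < n
    δ<n = <-trans (m<m+n δ (s≤s z≤n)) δ+1<n
    nonadjacent : ¬ CycleAdj n x y
    nonadjacent a with CycleAdj⇒Congruent a
    ... | inj₁ e′ = <⇒≢ 2≤δ (sym (Congruent⇒≡ δ<n (<-trans 2≤δ δ<n) (Congruent-cancel x (Congruent-trans e (Congruent-sym e′)))))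
    ... | inj₂ e′ = m+1+n≢0 δ (Congruent⇒≡ δ+1<n (≤-<-trans z≤n δ<n) (Congruent-cancel x
        (subst₂ (Congruent n) (+-assoc x δ 1) (sym (+-identityʳ x)) (Congruent-trans (Congruent-+ 1 e) e′))))

-- The rim is traversed in the order 0, 2, 4, …, 1, 3, 5, …, so that successive vertices differ by 2 or 3
-- modulo n; position is the rank of a vertex in this order.
position : ℕ → ℕ → ℕ
position n x = x / 2 + (x % 2) * (suc n / 2)

module _ {n : ℕ} where

  -- `suc n / 2` is ⌈n / 2⌉, the number of even rim vertices and hence the rank of vertex 1; the
  -- constructors name the parity of `n`.
  data Halves : ℕ → Set where
    odd  : ∀ h → suc n ≡ h * 2 → Halves h
    even : ∀ h → n ≡ h * 2 → Halves h

  halves : Halves (suc n / 2)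
  halves with suc n / 2 | suc n % 2 | m≡m%n+[m/n]*n (suc n) 2 | m%n<n (suc n) 2
  ... | h | 0 | eq | _ = odd h eq
  ... | h | 1 | eq | _ = even h (suc-injective eq)
  ... | _ | suc (suc _) | _ | s≤s (s≤s ())

  data Parity : ℕ → ℕ → Set where
    even : ∀ a → Parity (a * 2) a
    odd  : ∀ a → Parity (suc (a * 2)) (a + (suc n / 2))

  parity : ∀ x → Parity x (position n x)
  parity x with x / 2 | x % 2 | m≡m%n+[m/n]*n x 2 | m%n<n x 2
  ... | a | 0 | refl | _ = subst (Parity (a * 2)) (sym (+-identityʳ a)) (even a)
  ... | a | 1 | refl | _ = subst (λ h → Parity (suc (a * 2)) (a + h)) (sym (+-identityʳ _)) (odd a)
  ... | _ | suc (suc _) | _ | s≤s (s≤s ())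

  n≤2*half : ∀ {h} → Halves h → n ≤ h * 2
  n≤2*half (odd h eq) = ≤-trans (n≤1+n n) (≤-reflexive eq)
  n≤2*half (even h eq) = ≤-reflexive eq

  2*half≤1+n : ∀ {h} → Halves h → h * 2 ≤ suc n
  2*half≤1+n (odd h eq) = ≤-reflexive (sym eq)
  2*half≤1+n (even h eq) = ≤-trans (≤-reflexive (sym eq)) (n≤1+n n)

  even<half : ∀ a → a * 2 < n → a < suc n / 2
  even<half a a<n = *-cancelʳ-< 2 a _ (<-≤-trans a<n (n≤2*half halves))

  position< : ∀ x → x < n → position n x < n
  position< x x<n with position n x | parity x
  ... | _ | even a = ≤-<-trans (m≤m*n a 2) x<n
  ... | _ | odd a = *-cancelˡ-< 2 _ _ (linear 0 (2*half≤1+n halves ⊹ x<n) (lemma a n (suc n / 2)))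
    where
    lemma : ∀ a n h → suc (2 * (a + h)) + (suc n + n) + 0 ≡ 2 * n + (h * 2 + suc (suc (a * 2)))
    lemma = solve-∀

  position-injective : ∀ x y → x < n → y < n → position n x ≡ position n y → x ≡ y
  position-injective x y x<n y<n eq with position n x | parity x | position n y | parity y
  position-injective x y x<n y<n refl | _ | even a | _ | even _ = refl
  position-injective x y x<n y<n eq   | _ | even a | _ | odd b =
    ⊥-elim (<⇒≱ (even<half a x<n) (≤-trans (m≤n+m _ b) (≤-reflexive (sym eq))))

  position-injective x y x<n y<n eq   | _ | odd a | _ | even b =
    ⊥-elim (<⇒≱ (even<half b y<n) (≤-trans (m≤n+m _ a) (≤-reflexive eq)))

  position-injective x y x<n y<n eq   | _ | odd a | _ | odd b = cong (λ c → suc (c * 2)) (+-cancelʳ-≡ _ a b eq)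

  -- Inside a parity class the step is 2. The one remaining step leads from the last even vertex to
  -- 1: from n - 1, a step of 2 modulo n, if n is odd, and from n - 2, a step of 3, if n is even.
  position-suc : ∀ x y → x < n → y < n → position n y ≡ suc (position n x) → Congruent n (x + 2) y ⊎ Congruent n (x + 3) y
  position-suc x y x<n y<n eq with position n x | parity x | position n y | parity y
  position-suc x y x<n y<n refl | _ | even a | _ | even _ = inj₁ (0 , 0 , cong (_+ 0) (+-comm (a * 2) 2))
  position-suc x y x<n y<n eq | _ | odd a | _ | even b =
    ⊥-elim (<⇒≱ (even<half b y<n) (≤-trans (m≤n+m _ (suc a)) (≤-reflexive (sym eq))))

  position-suc x y x<n y<n eq | _ | odd a | _ | odd b = inj₁ (0 , 0 , lemma a b (+-cancelʳ-≡ _ b (suc a) eq))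
    where
    lemma : ∀ a b → b ≡ suc a → suc (a * 2) + 2 + 0 ≡ suc (b * 2) + 0
    lemma a b refl = cong (λ x → suc (x + 0)) (+-comm (a * 2) 2)
  position-suc x y x<n y<n eq | _ | even a | _ | odd b = wrap halves (even<half a x<n) eq
    where
    wrap : ∀ {h} → Halves h → a < h → b + h ≡ suc a → Congruent n (a * 2 + 2) (suc (b * 2)) ⊎ Congruent n (a * 2 + 3) (suc (b * 2))
    wrap {h} H a<h eq with ≤-antisym a<h (≤-trans (m≤n+m h b) (≤-reflexive eq))
    ... | refl with +-cancelʳ-≡ (suc a) b 0 eq
    wrap (odd _ n≡) a<h eq | refl | refl =
      inj₁ (0 , 1 , trans (lemma a) (trans (sym n≡) (cong suc (sym (+-identityʳ n)))))
      where
      lemma : ∀ a → a * 2 + 2 + 0 ≡ suc a * 2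
      lemma = solve-∀
    wrap (even _ n≡) a<h eq | refl | refl =
      inj₂ (0 , 1 , trans (lemma a) (cong suc (trans (sym n≡) (sym (+-identityʳ n)))))
      where
      lemma : ∀ a → a * 2 + 3 + 0 ≡ suc (suc a * 2)
      lemma = solve-∀

module Rim {n : ℕ} (7≤n : 7 ≤ n) where

  private instance
    n≢0 : NonZero n
    n≢0 = >-nonZero (≤-trans (s≤s z≤n) 7≤n)

  unshift : ℕ → ℕ → ℕ
  unshift t v = (v + (n ∸ t)) % n

  unshift< : ∀ t v → unshift t v < n
  unshift< t v = m%n<n (v + (n ∸ t)) n

  unshift-Congruent : ∀ t v → t ≤ n → Congruent n (unshift t v + t) v
  unshift-Congruent t v t≤n = (v + (n ∸ t)) / n , 1 , (begin
    unshift t v + t + (v + (n ∸ t)) / n * n     ≡⟨ swap₃ (unshift t v) t _ ⟩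
    unshift t v + (v + (n ∸ t)) / n * n + t     ≡⟨ cong (_+ t) (m≡m%n+[m/n]*n (v + (n ∸ t)) n) ⟨
    v + (n ∸ t) + t                             ≡⟨ +-assoc v (n ∸ t) t ⟩
    v + (n ∸ t + t)                             ≡⟨ cong (v +_) (m∸n+n≡m t≤n) ⟩
    v + n                                       ≡⟨ cong (v +_) (+-identityʳ n) ⟨
    v + 1 * n                                   ∎)
    where
    open ≡-Reasoning

  -- slot t v is the rank at which v is visited by the traversal shifted by t.
  slot : ℕ → ℕ → ℕ
  slot t v = position n (unshift t v)

  slot< : ∀ t v → slot t v < n
  slot< t v = position< (unshift t v) (unshift< t v)

  -- The unshifted positions are v - t and v′ - t′; adding t + t′ on both sides avoids the
  -- subtractions.
  slot-offset : ∀ t v t′ v′ c → t ≤ n → t′ ≤ n → Congruent n (unshift t v + c) (unshift t′ v′) → Congruent n (v + (c + t′)) (v′ + t)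
  slot-offset t v t′ v′ c t≤n t′≤n e =
    Congruent-trans (Congruent-+ (c + t′) (Congruent-sym (unshift-Congruent t v t≤n)))
      (subst₂ (Congruent n) (lemma (unshift t v) t c t′) refl
        (Congruent-trans (Congruent-+ (t′ + t) e)
          (subst (λ z → Congruent n z (v′ + t)) (+-assoc (unshift t′ v′) t′ t)
            (Congruent-+ t (unshift-Congruent t′ v′ t′≤n)))))
    where
    lemma : ∀ u t c t′ → u + c + (t′ + t) ≡ u + t + (c + t′)
    lemma = solve-∀

  slot-same : ∀ t v t′ v′ → t ≤ n → t′ ≤ n → slot t v ≡ slot t′ v′ → Congruent n (v + t′) (v′ + t)
  slot-same t v t′ v′ t≤n t′≤n eq = slot-offset t v t′ v′ 0 t≤n t′≤n
    (0 , 0 , cong (_+ 0) (trans (+-identityʳ _) (position-injective (unshift t v) (unshift t′ v′) (unshift< t v) (unshift< t′ v′) eq)))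

  slot-next : ∀ t v t′ v′ → t ≤ n → t′ ≤ n → slot t′ v′ ≡ suc (slot t v) →
              Congruent n (v + (2 + t′)) (v′ + t) ⊎ Congruent n (v + (3 + t′)) (v′ + t)
  slot-next t v t′ v′ t≤n t′≤n eq = Sum.map (slot-offset t v t′ v′ 2 t≤n t′≤n) (slot-offset t v t′ v′ 3 t≤n t′≤n)
    (position-suc (unshift t v) (unshift t′ v′) (unshift< t v) (unshift< t′ v′) eq)

  -- For a literal `k` the implicit argument has type ⊤ and is filled in by unification.
  small : ∀ k → {T (k ≤ᵇ 7)} → k ≤ n
  small k {k≤7} = ≤-trans (≤ᵇ⇒≤ k 7 k≤7) 7≤n

  apart : ∀ {x y} δ c → {T (2 ≤ᵇ δ)} → {T (δ + 2 ≤ᵇ 7)} → Congruent n (x + (δ + c)) (y + c) → rimDist n x y ≡ 2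
  apart δ c {lo} {hi} e = shifted-apart δ (cancel-shift δ c e) (≤ᵇ⇒≤ 2 δ lo) (small (δ + 2) {hi})

  apart′ : ∀ {x y} δ c → {T (2 ≤ᵇ δ)} → {T (δ + 2 ≤ᵇ 7)} → Congruent n (x + c) (y + (δ + c)) → rimDist n x y ≡ 2
  apart′ {x} {y} δ c {lo} {hi} e = trans (rimDist-sym n x y) (apart δ c {lo} {hi} (Congruent-sym e))

  distinct′ : ∀ {x y} δ c → {T (1 ≤ᵇ δ)} → {T (suc δ ≤ᵇ 7)} → Congruent n (x + c) (y + (δ + c)) → 1 ≤ rimDist n x y
  distinct′ {x} {y} δ c {lo} {hi} e = rimDist-distinct {n}
    (λ x≡y → shifted-distinct δ (cancel-shift δ c (Congruent-sym e)) (≤ᵇ⇒≤ 1 δ lo) (small (suc δ) {hi}) (sym x≡y))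

  slot-injective : ∀ t v v′ → t ≤ n → v < n → v′ < n → slot t v ≡ slot t v′ → v ≡ v′
  slot-injective t v v′ t≤n v<n v′<n eq = Congruent⇒≡ v<n v′<n
    (subst (λ z → Congruent n z v′) (+-identityʳ v) (cancel-shift 0 t (slot-same t v t v′ t≤n t≤n eq)))

  slot-next-apart : ∀ t v v′ → t ≤ n → slot t v′ ≡ suc (slot t v) → rimDist n v v′ ≡ 2
  slot-next-apart t v v′ t≤n eq = Sum.[ apart 2 t , apart 3 t ]′ (slot-next t v t v′ t≤n t≤n eq)

  -- Why the shift is 5 = 2 + 3: at equal ranks the two vertices differ by 5, at successive ranks by
  -- 5 - 2 or 5 - 3. All of these lie between 2 and n - 2, which for 5 means n ≥ 7.
  slot₅₀-same : ∀ v v′ → slot 5 v ≡ slot 0 v′ → rimDist n v v′ ≡ 2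
  slot₅₀-same v v′ eq = apart′ 5 0 (slot-same 5 v 0 v′ (small 5) z≤n eq)

  slot₅₀-next : ∀ v v′ → slot 0 v′ ≡ suc (slot 5 v) → rimDist n v v′ ≡ 2
  slot₅₀-next v v′ eq = Sum.[ apart′ 3 2 , apart′ 2 3 ]′ (slot-next 5 v 0 v′ (small 5) z≤n eq)

  -- The visits of one revolution are bottom, top, centre, with shifts 0, 2, 6. Consecutive visits
  -- thus differ by 2, by 6 - 2, and, on passing to the next rank, by 6 - 2 or 6 - 3.
  slot₀₂-same : ∀ v v′ → slot 0 v ≡ slot 2 v′ → rimDist n v v′ ≡ 2
  slot₀₂-same v v′ eq = apart 2 0 (slot-same 0 v 2 v′ z≤n (small 2) eq)

  slot₆₂-same : ∀ v v′ → slot 6 v ≡ slot 2 v′ → rimDist n v v′ ≡ 2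
  slot₆₂-same v v′ eq = apart′ 4 2 (slot-same 6 v 2 v′ (small 6) (small 2) eq)

  slot₆₀-next : ∀ v v′ → slot 0 v′ ≡ suc (slot 6 v) → rimDist n v v′ ≡ 2
  slot₆₀-next v v′ eq = Sum.[ apart′ 4 2 , apart′ 3 3 ]′ (slot-next 6 v 0 v′ (small 6) z≤n eq)

  -- Here and in `slot₆₂-next` the vertices are two visits apart and need only be distinct. They can
  -- be adjacent: 6 ≡ -1 when n = 7, and the next lemma meets the difference 6 - 5.
  slot₆₀-same : ∀ v v′ → slot 6 v ≡ slot 0 v′ → 1 ≤ rimDist n v v′
  slot₆₀-same v v′ eq = distinct′ 6 0 (slot-same 6 v 0 v′ (small 6) z≤n eq)

  slot₆₂-next : ∀ v v′ → slot 2 v′ ≡ suc (slot 6 v) → 1 ≤ rimDist n v v′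
  slot₆₂-next v v′ eq = Sum.[ distinct′ 2 4 , distinct′ 1 5 ]′ (slot-next 6 v 2 v′ (small 6) (small 2) eq)

-- Optimal labelings

-- A record rather than a plain inequality: the labels x and y could not be inferred from ∣ x - y ∣.
record Spaced (e x y d : ℕ) : Set where
  constructor spaced
  field spacing : e ≤ ∣ x - y ∣ + d

open Spaced

-- No order of the labels has to be known, since y ∸ x ≤ |x - y| in any case.
above : ∀ {e x y d} → x + e ≤ y + d → Spaced e x y d
above {e} {x} {y} {d} h = spaced (linear 0 (h ⊹ m≤n+∣n-m∣ y x) (lemma e x y d ∣ x - y ∣))
  where
  lemma : ∀ e x y d t → e + (y + d + (x + t)) + 0 ≡ t + d + (x + e + y)
  lemma = solve-∀

spaced-sym : ∀ {e x y d d′} → d ≡ d′ → Spaced e x y d → Spaced e y x d′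
spaced-sym {e} {x} {y} refl (spaced h) = spaced (subst (λ t → e ≤ t + _) (∣-∣-comm x y) h)

below : ∀ {e x y d} → y + e ≤ x + d → Spaced e x y d
below h = spaced-sym refl (above h)

spaced-shift : ∀ {e x y d} c → Spaced e x y d → Spaced e (c + x) (c + y) d
spaced-shift {e} {x} {y} {d} c (spaced h) = spaced (subst (λ t → e ≤ t + d) (sym (∣m+n-m+o∣≡∣n-o∣ c x y)) h)

data Side : Set where
  first last : Side

sideDist : ℕ → Side → Side → ℕ
sideDist r first first = 0
sideDist r first last  = r
sideDist r last  first = r
sideDist r last  last  = 0

-- Two rows at distance r are labelled alternately: the hub of the first one, then rim vertices of the
-- last and the first row in turn, then the hub of the last one.  Successive labels differ by g, or by
-- g + 1 next to a hub.
module Block {n : ℕ} (7≤n : 7 ≤ n) (r g : ℕ) (r≤g : r ≤ g) (2≤g : 2 ≤ g) where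

  open Rim 7≤n

  blockLabel : Side → Fin (suc n) → ℕ
  blockLabel first fzero    = 0
  blockLabel first (fsuc v) = (2 * slot 5 (toℕ v) + 2) * g + 1
  blockLabel last  (fsuc v) = (2 * slot 0 (toℕ v) + 1) * g + 1
  blockLabel last  fzero    = (2 * n + 1) * g + 2

  -- There are 2 n + 2 gaps, counting the jump to the next block. Three exceed `g` by 1: after the
  -- first hub, before the last hub, and the jump between hubs.
  blockPeriod : ℕ
  blockPeriod = (2 * n + 2) * g + 3

  -- This is diam + 1: 2 r + 2 for even m, where `g` is `r`, and 2 r + 3 for odd m, where `g` is
  -- `r + 1`.
  bound : ℕ
  bound = g + r + 2

  -- At successive ranks the labels differ by 2 g, which may fall short of `bound` by 2, so wheel
  -- distance 2 is required. From two ranks on, 4 g is enough.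
  same-row< : ∀ i j d c → i < j → (j ≡ suc i → d ≡ 2) → (2 * i + c) * g + 1 + bound ≤ (2 * j + c) * g + 1 + d
  same-row< i j d c i<j near with m≤n⇒m<n∨m≡n i<j
  ... | inj₁ i+2≤j = linear (d + g) (2 ⊛ *-monoˡ-≤ g i+2≤j ⊹ r≤g ⊹ 2≤g) (lemma i j d c r g)
    where
    lemma : ∀ i j d c r g → (2 * i + c) * g + 1 + (g + r + 2) + (2 * (j * g) + g + g) + (d + g)
                            ≡ (2 * j + c) * g + 1 + d + (2 * (g + (g + i * g)) + r + 2)
    lemma = solve-∀
  ... | inj₂ refl rewrite near refl = linear 0 r≤g (lemma i c r g)
    where
    lemma : ∀ i c r g → (2 * i + c) * g + 1 + (g + r + 2) + g + 0 ≡ (2 * suc i + c) * g + 1 + 2 + r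
    lemma = solve-∀

  same-row : ∀ t v v′ c → t ≤ n → v < n → v′ < n → ¬ v ≡ v′ →
             Spaced bound ((2 * slot t v + c) * g + 1) ((2 * slot t v′ + c) * g + 1) (rimDist n v v′)
  same-row t v v′ c t≤n v<n v′<n v≢v′ with <-cmp (slot t v) (slot t v′)
  ... | tri< i<j _ _ = above (same-row< _ _ _ c i<j (slot-next-apart t v v′ t≤n))
  ... | tri≈ _ i≡j _ = ⊥-elim (v≢v′ (slot-injective t v v′ t≤n v<n v′<n i≡j))
  ... | tri> _ _ j<i = below (same-row< _ _ _ c j<i (λ eq → trans (rimDist-sym n v v′) (slot-next-apart t v′ v t≤n eq)))

  -- The visits are consecutive only at equal ranks, where `v′` comes first, and when `v′` has the
  -- next rank. There the gap is `g` and wheel distance 2 is needed; otherwise it is at least 3 g.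
  opposite-rows : ∀ v v′ → Spaced bound ((2 * slot 5 v + 2) * g + 1) ((2 * slot 0 v′ + 1) * g + 1) (r + rimDist n v v′)
  opposite-rows v v′ with <-cmp (slot 5 v) (slot 0 v′)
  ... | tri≈ _ i≡j _ = below (linear 0 (≤-reflexive (cong₂ (λ i d → (2 * i + 2) * g + 1 + (r + d)) (sym i≡j) (sym (slot₅₀-same v v′ i≡j))))
                                (lemma (slot 5 v) (slot 0 v′) g r (rimDist n v v′)))
    where
    lemma : ∀ i j g r d → (2 * j + 1) * g + 1 + (g + r + 2) + ((2 * i + 2) * g + 1 + (r + d)) + 0
                        ≡ (2 * i + 2) * g + 1 + (r + d) + ((2 * j + 2) * g + 1 + (r + 2))
    lemma = solve-∀
  ... | tri> _ _ j<i = below (linear (g + rimDist n v v′) (2 ⊛ *-monoˡ-≤ g j<i ⊹ 2≤g) (lemma (slot 5 v) (slot 0 v′) g r (rimDist n v v′)))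
    where
    lemma : ∀ i j g r d → (2 * j + 1) * g + 1 + (g + r + 2) + (2 * (i * g) + g) + (g + d)
                        ≡ (2 * i + 2) * g + 1 + (r + d) + (2 * (g + j * g) + 2)
    lemma = solve-∀
  ... | tri< i<j _ _ with m≤n⇒m<n∨m≡n i<j
  ...   | inj₁ i+2≤j = above (linear (g + rimDist n v v′) (2 ⊛ *-monoˡ-≤ g i+2≤j ⊹ 2≤g) (lemma (slot 5 v) (slot 0 v′) g r (rimDist n v v′)))
    where
    lemma : ∀ i j g r d → (2 * i + 2) * g + 1 + (g + r + 2) + (2 * (j * g) + g) + (g + d)
                        ≡ (2 * j + 1) * g + 1 + (r + d) + (2 * (g + (g + i * g)) + 2)
    lemma = solve-∀
  ...   | inj₂ 1+i≡j = above (linear 0 (≤-reflexive (cong₂ (λ j d → (2 * j + 1) * g + 1 + (r + d)) 1+i≡j (sym (slot₅₀-next v v′ (sym 1+i≡j)))))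
                                (lemma (slot 5 v) (slot 0 v′) g r (rimDist n v v′)))
    where
    lemma : ∀ i j g r d → (2 * i + 2) * g + 1 + (g + r + 2) + ((2 * j + 1) * g + 1 + (r + d)) + 0
                        ≡ (2 * j + 1) * g + 1 + (r + d) + ((2 * suc i + 1) * g + 1 + (r + 2))
    lemma = solve-∀

  first-hub : ∀ v → Spaced bound 0 (blockLabel first (fsuc v)) 1
  first-hub v = above {x = 0} (linear (2 * (slot 5 (toℕ v) * g)) r≤g (lemma (slot 5 (toℕ v)) g r))
    where
    lemma : ∀ i g r → g + r + 2 + g + 2 * (i * g) ≡ (2 * i + 2) * g + 1 + 1 + r
    lemma = solve-∀

  last-hub : ∀ v → Spaced bound (blockLabel last (fsuc v)) (blockLabel last fzero) 1
  last-hub v = above (linear 0 (2 ⊛ *-monoˡ-≤ g (slot< 0 (toℕ v)) ⊹ r≤g) (lemma (slot 0 (toℕ v)) n g r))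
    where
    lemma : ∀ i n g r → (2 * i + 1) * g + 1 + (g + r + 2) + (2 * (n * g) + g) + 0
              ≡ (2 * n + 1) * g + 2 + 1 + (2 * (g + i * g) + r)
    lemma = solve-∀

  first-last : ∀ h h′ → Spaced bound (blockLabel first h) (blockLabel last h′) (r + wheelDist h h′)
  first-last fzero fzero = above {x = 0} (linear {l = 0} (2 * (n * g)) z≤n (lemma n g r))
    where
    lemma : ∀ n g r → g + r + 2 + 0 + 2 * (n * g) ≡ (2 * n + 1) * g + 2 + (r + 0) + 0
    lemma = solve-∀
  first-last fzero (fsuc v) =
    above {x = 0} (linear {l = 0} (2 * (slot 0 (toℕ v) * g)) z≤n (lemma (slot 0 (toℕ v)) g r))
    where
    lemma : ∀ i g r → g + r + 2 + 0 + 2 * (i * g) ≡ (2 * i + 1) * g + 1 + (r + 1) + 0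
    lemma = solve-∀
  first-last (fsuc v) fzero = above (linear 0 (2 ⊛ *-monoˡ-≤ g (slot< 5 (toℕ v))) (lemma (slot 5 (toℕ v)) n g r))
    where
    lemma : ∀ i n g r → (2 * i + 2) * g + 1 + (g + r + 2) + 2 * (n * g) + 0
              ≡ (2 * n + 1) * g + 2 + (r + 1) + 2 * (g + i * g)
    lemma = solve-∀
  first-last (fsuc v) (fsuc v′) = opposite-rows (toℕ v) (toℕ v′)

  block-separated : ∀ s h s′ h′ → ¬ (s , h) ≡ (s′ , h′) →
                    Spaced bound (blockLabel s h) (blockLabel s′ h′) (sideDist r s s′ + wheelDist h h′)
  block-separated first fzero first fzero u≢v = ⊥-elim (u≢v refl)
  block-separated first fzero first (fsuc v) _ = first-hub v
  block-separated first (fsuc v) first fzero _ = spaced-sym refl (first-hub v)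
  block-separated first (fsuc v) first (fsuc v′) u≢v =
    same-row 5 (toℕ v) (toℕ v′) 2 (small 5) (toℕ<n v) (toℕ<n v′) (λ eq → u≢v (cong (λ w → first , fsuc w) (toℕ-injective eq)))
  block-separated last fzero last fzero u≢v = ⊥-elim (u≢v refl)
  block-separated last (fsuc v) last fzero _ = last-hub v
  block-separated last fzero last (fsuc v) _ = spaced-sym refl (last-hub v)
  block-separated last (fsuc v) last (fsuc v′) u≢v =
    same-row 0 (toℕ v) (toℕ v′) 1 z≤n (toℕ<n v) (toℕ<n v′) (λ eq → u≢v (cong (λ w → last , fsuc w) (toℕ-injective eq)))
  block-separated first h last h′ _ = first-last h h′
  block-separated last h first h′ _ = spaced-sym (cong (r +_) (wheelDist-sym h′ h)) (first-last h′ h)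

  blockLabel-end : ∀ s h → (s , h) ≡ (last , fzero) ⊎ blockLabel s h + (2 * g + 2) ≤ blockPeriod
  blockLabel-end first fzero = inj₂ (linear (2 * (n * g) + 1) (z≤n {0}) (lemma n g))
    where
    lemma : ∀ n g → 0 + (2 * g + 2) + 0 + (2 * (n * g) + 1) ≡ (2 * n + 2) * g + 3 + 0
    lemma = solve-∀
  blockLabel-end first (fsuc v) = inj₂ (linear 0 (2 ⊛ *-monoˡ-≤ g (slot< 5 (toℕ v))) (lemma (slot 5 (toℕ v)) n g))
    where
    lemma : ∀ i n g → (2 * i + 2) * g + 1 + (2 * g + 2) + 2 * (n * g) + 0 ≡ (2 * n + 2) * g + 3 + 2 * (g + i * g)
    lemma = solve-∀
  blockLabel-end last (fsuc v) = inj₂ (linear g (2 ⊛ *-monoˡ-≤ g (slot< 0 (toℕ v))) (lemma (slot 0 (toℕ v)) n g))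
    where
    lemma : ∀ i n g → (2 * i + 1) * g + 1 + (2 * g + 2) + 2 * (n * g) + g ≡ (2 * n + 2) * g + 3 + 2 * (g + i * g)
    lemma = solve-∀
  blockLabel-end last fzero = inj₁ refl

  blockLabel-start : ∀ s h → (s , h) ≡ (first , fzero) ⊎ suc g ≤ blockLabel s h
  blockLabel-start first fzero = inj₁ refl
  blockLabel-start first (fsuc v) =
    inj₂ (linear {l = 0} (2 * (slot 5 (toℕ v) * g) + g) z≤n (lemma (slot 5 (toℕ v)) g))
    where
    lemma : ∀ i g → suc g + 0 + (2 * (i * g) + g) ≡ (2 * i + 2) * g + 1 + 0
    lemma = solve-∀
  blockLabel-start last (fsuc v) = inj₂ (linear {l = 0} (2 * (slot 0 (toℕ v) * g)) z≤n (lemma (slot 0 (toℕ v)) g))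
    where
    lemma : ∀ i g → suc g + 0 + (2 * (i * g)) ≡ (2 * i + 1) * g + 1 + 0
    lemma = solve-∀
  blockLabel-start last fzero = inj₂ (linear {l = 0} (2 * (n * g) + 1) z≤n (lemma n g))
    where
    lemma : ∀ n g → suc g + 0 + (2 * (n * g) + 1) ≡ (2 * n + 1) * g + 2 + 0
    lemma = solve-∀

  blockLabel-max : ∀ s h → blockLabel s h + suc g ≤ blockPeriod
  blockLabel-max s h with blockLabel-end s h
  ... | inj₁ refl = linear {l = 0} 0 z≤n (lemma n g)
    where
    lemma : ∀ n g → (2 * n + 1) * g + 2 + suc g + 0 + 0 ≡ (2 * n + 2) * g + 3 + 0
    lemma = solve-∀
  ... | inj₂ end = linear (suc g) end (lemma (blockLabel s h) g blockPeriod)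
    where
    lemma : ∀ x g p → x + suc g + p + suc g ≡ p + (x + (2 * g + 2))
    lemma = solve-∀

  bound≤ : bound ≤ 2 * g + 2
  bound≤ = linear 0 r≤g (lemma g r)
    where
    lemma : ∀ g r → g + r + 2 + g + 0 ≡ 2 * g + 2 + r
    lemma = solve-∀

  -- The labels alone suffice, except from the last hub of a block to the first hub of the next.
  -- These differ by g + 1, and `near` supplies the missing distance r + 1.
  blocks-separated : ∀ p s h p′ s′ h′ d → p < p′ →
    (p′ ≡ suc p → (s , h) ≡ (last , fzero) → (s′ , h′) ≡ (first , fzero) → suc r ≤ d) →
    p * blockPeriod + blockLabel s h + bound ≤ p′ * blockPeriod + blockLabel s′ h′ + d
  blocks-separated p s h p′ s′ h′ d p<p′ near with m≤n⇒m<n∨m≡n p<p′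
  ... | inj₁ p+2≤p′ = linear (blockLabel s′ h′ + d + suc g + 2 * (n * g) + 1) (*-monoˡ-≤ blockPeriod p+2≤p′ ⊹ blockLabel-max s h ⊹ bound≤)
      (lemma (p * blockPeriod) (p′ * blockPeriod) (blockLabel s h) (blockLabel s′ h′) d n g bound)
    where
    lemma : ∀ P P′ x y d n g b → P + x + b + (P′ + ((2 * n + 2) * g + 3) + (2 * g + 2)) + (y + d + suc g + 2 * (n * g) + 1)
                              ≡ P′ + y + d + ((2 * n + 2) * g + 3 + ((2 * n + 2) * g + 3 + P) + (x + suc g) + b)
    lemma = solve-∀
  ... | inj₂ refl with blockLabel-end s h | blockLabel-start s′ h′
  ...   | inj₂ end | _ = linear (blockLabel s′ h′ + d) (end ⊹ bound≤)
      (lemma (p * blockPeriod) blockPeriod (blockLabel s h) (blockLabel s′ h′) d g bound)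
    where
    lemma : ∀ P B x y d g b → P + x + b + (B + (2 * g + 2)) + (y + d) ≡ B + P + y + d + (x + (2 * g + 2) + b)
    lemma = solve-∀
  ...   | inj₁ _ | inj₂ start = linear d (blockLabel-max s h ⊹ start ⊹ bound≤)
      (lemma (p * blockPeriod) blockPeriod (blockLabel s h) (blockLabel s′ h′) d g bound)
    where
    lemma : ∀ P B x y d g b → P + x + b + (B + y + (2 * g + 2)) + d ≡ B + P + y + d + (x + suc g + suc g + b)
    lemma = solve-∀
  ...   | inj₁ e | inj₁ e′ = linear (blockLabel s′ h′) (blockLabel-max s h ⊹ near refl e e′)
      (lemma (p * blockPeriod) blockPeriod (blockLabel s h) (blockLabel s′ h′) d g r)
    where
    lemma : ∀ P B x y d g r → P + x + (g + r + 2) + (B + d) + y ≡ B + P + y + d + (x + suc g + suc r)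
    lemma = solve-∀

  pairLabel : Side → ℕ → Fin (suc n) → ℕ
  pairLabel s p h = p * blockPeriod + blockLabel s h

  -- The period includes a jump of g + 1 to a following block; after the final block it is saved.
  pairLabel-max : ∀ s p h {k} → suc p ≤ k → pairLabel s p h + suc g ≤ k * blockPeriod
  pairLabel-max s p h {k} p<k = linear 0 (blockLabel-max s h ⊹ *-monoˡ-≤ blockPeriod p<k)
    (lemma (p * blockPeriod) (blockLabel s h) g blockPeriod (k * blockPeriod))
    where
    lemma : ∀ P x g B t → P + x + suc g + (B + t) + 0 ≡ t + (x + suc g + (B + P))
    lemma = solve-∀

  -- The p-th block consists of the rows q and r + q with p + q + 1 = r.
  row : Side → ℕ → ℕ
  row first q = q
  row last  q = r + q

  row-dist : ∀ s s′ q → ∣ row s q - row s′ q ∣ ≡ sideDist r s s′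
  row-dist first first q = ∣n-n∣≡0 q
  row-dist first last  q = trans (cong (∣ q -_∣) (+-comm r q)) (∣m-m+n∣≡n q r)
  row-dist last  first q = trans (∣-∣-comm (r + q) q) (row-dist first last q)
  row-dist last  last  q = ∣n-n∣≡0 (r + q)

  -- Why q falls as p grows: the jump from row r + q to row q - 1 has length r + 1, whereas a jump
  -- to row q + 1 would only have r - 1.
  pairs-ordered : ∀ s p q h s′ p′ q′ h′ → suc (p + q) ≡ r → suc (p′ + q′) ≡ r → p < p′ →
    Spaced bound (pairLabel s p h) (pairLabel s′ p′ h′) (∣ row s q - row s′ q′ ∣ + wheelDist h h′)
  pairs-ordered s p q h s′ p′ q′ h′ eq eq′ p<p′ = above (blocks-separated p s h p′ s′ h′ _ p<p′ near)
    where
    near : p′ ≡ suc p → (s , h) ≡ (last , fzero) → (s′ , h′) ≡ (first , fzero) →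
           suc r ≤ ∣ row s q - row s′ q′ ∣ + wheelDist h h′
    near refl refl refl = linear 0 (m≤∣m-n∣+n (r + q) q′ ⊹ ≤-reflexive q≡) (lemma r q q′ ∣ r + q - q′ ∣)
      where
      q≡ : suc q′ ≡ q
      q≡ = +-cancelˡ-≡ p (suc q′) q (trans (+-suc p q′) (suc-injective (trans eq′ (sym eq))))
      lemma : ∀ r q q′ d → suc r + (d + q′ + q) + 0 ≡ d + 0 + (r + q + suc q′)
      lemma = solve-∀

  pairs-separated : ∀ s p q h s′ p′ q′ h′ → suc (p + q) ≡ r → suc (p′ + q′) ≡ r →
    ¬ (row s q , h) ≡ (row s′ q′ , h′) →
    Spaced bound (pairLabel s p h) (pairLabel s′ p′ h′) (∣ row s q - row s′ q′ ∣ + wheelDist h h′)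
  pairs-separated s p q h s′ p′ q′ h′ eq eq′ u≢v with <-cmp p p′
  ... | tri< p<p′ _ _ = pairs-ordered s p q h s′ p′ q′ h′ eq eq′ p<p′
  ... | tri> _ _ p′<p = spaced-sym (cong₂ _+_ (∣-∣-comm (row s′ q′) (row s q)) (wheelDist-sym h′ h))
                                   (pairs-ordered s′ p′ q′ h′ s p q h eq′ eq p′<p)
  ... | tri≈ _ refl _ with +-cancelˡ-≡ p q q′ (suc-injective (trans eq (sym eq′)))
  ...   | refl = spaced-shift (p * blockPeriod)
      (subst (λ d → Spaced bound _ _ (d + wheelDist h h′)) (sym (row-dist s s′ q))
             (block-separated s h s′ h′ (λ { refl → u≢v refl })))

  pairOf : ∀ i → i < r + r → ∃[ s ] ∃[ p ] ∃[ q ] (suc (p + q) ≡ r × row s q ≡ i)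
  pairOf i i<2r with i <? r
  ... | yes i<r = first , r ∸ suc i , i , trans (sym (+-suc (r ∸ suc i) i)) (m∸n+n≡m i<r) , refl
  ... | no i≮r = last , r ∸ suc (i ∸ r) , i ∸ r
      , trans (sym (+-suc (r ∸ suc (i ∸ r)) (i ∸ r))) (m∸n+n≡m (+-cancelˡ-< r _ _ (subst (_< r + r) (sym i≡) i<2r))) , i≡
    where
    i≡ : r + (i ∸ r) ≡ i
    i≡ = m+[n∸m]≡n (≮⇒≥ i≮r)

-- The lower bound, applied to `φ` itself, also shows that its span is attained.
isRadioNumber : ∀ {G R} φ → IsRadioLabeling G φ → (∀ v → φ v ≤ R) →
                (∀ φ → IsRadioLabeling G φ → ∃[ u ] ∃[ v ] (R ≤ ∣ φ u - φ v ∣)) → IsRadioNumber G R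
isRadioNumber {G} {R} φ radio φ≤R spread =
  (φ , radio , upper , attained) , λ ψ ψ-radio s (ψ≤s , _) → lower ψ s ψ≤s (spread ψ ψ-radio)
  where
  upper : ∀ u v → ∣ φ u - φ v ∣ ≤ R
  upper u v = ≤-trans (∣m-n∣≤m⊔n (φ u) (φ v)) (⊔-lub (φ≤R u) (φ≤R v))
  attained : ∃[ u ] ∃[ v ] (∣ φ u - φ v ∣ ≡ R)
  attained with spread φ radio
  ... | u , v , R≤ = u , v , ≤-antisym (upper u v) R≤
  lower : ∀ ψ s → (∀ u v → ∣ ψ u - ψ v ∣ ≤ s) → ∃[ u ] ∃[ v ] (R ≤ ∣ ψ u - ψ v ∣) → R ≤ s
  lower ψ s ψ≤s (u , v , R≤) = ≤-trans R≤ (ψ≤s u v)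

-- The three rows left over when m = 2 r + 1 are labelled cyclically in the order centre, bottom, top.
data Special : Set where
  centre bottom top : Special

module ThreeRows {n : ℕ} (7≤n : 7 ≤ n) (k : ℕ) where

  r : ℕ
  r = suc k

  open Rim 7≤n
  open Block 7≤n r (suc r) (n≤1+n r) (s≤s (s≤s z≤n)) public

  specialRow : Special → ℕ
  specialRow centre = r
  specialRow bottom = 0
  specialRow top    = r + r

  shift : Special → ℕ
  shift centre = 6
  shift bottom = 0
  shift top    = 2

  -- The gaps of a revolution are 1 from bottom to top, at distance 2 r + 2, and r + 1 for each of
  -- the other two steps, at distance r + 2. The initial r + 2 is forced by the centre hub, labelled
  -- 0.
  offset : Special → ℕ
  offset centre = bound + 1
  offset bottom = r + 2
  offset top    = r + 3

  -- The last rim vertex, in the central row, has label n * bound + 1. Then come gaps r + 2 to the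
  -- bottom hub, at distance r + 1, and 3 to the top hub, at distance 2 r.
  hubLabel : Special → ℕ
  hubLabel centre = 0
  hubLabel bottom = n * bound + (r + 3)
  hubLabel top    = n * bound + (r + 6)

  specialLabel : Special → Fin (suc n) → ℕ
  specialLabel c fzero    = hubLabel c
  specialLabel c (fsuc v) = slot (shift c) (toℕ v) * bound + offset c

  -- The label of the top hub plus r + 2, the gap to the hub of row r - 1, which is at distance r +
  -- 1 and opens the first pair.
  specialPeriod : ℕ
  specialPeriod = n * bound + bound + 5

  specialDist : Special → Special → ℕ
  specialDist centre centre = 0
  specialDist bottom bottom = 0
  specialDist top    top    = 0
  specialDist bottom top    = r + r
  specialDist top    bottom = r + r
  specialDist _      _      = r

  special-row-dist : ∀ c c′ → ∣ specialRow c - specialRow c′ ∣ ≡ specialDist c c′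
  special-row-dist centre centre = ∣n-n∣≡0 r
  special-row-dist bottom bottom = refl
  special-row-dist top    top    = ∣n-n∣≡0 (r + r)
  special-row-dist bottom top    = refl
  special-row-dist top    bottom = refl
  special-row-dist centre bottom = refl
  special-row-dist centre top    = ∣m-m+n∣≡n r r
  special-row-dist bottom centre = refl
  special-row-dist top    centre = trans (∣-∣-comm (r + r) r) (∣m-m+n∣≡n r r)

  SpecialSpaced : Special → Fin (suc n) → Special → Fin (suc n) → Set
  SpecialSpaced c h c′ h′ = Spaced bound (specialLabel c h) (specialLabel c′ h′) (specialDist c c′ + wheelDist h h′)

  one-revolution : bound ≤ n * bound
  one-revolution = linear 0 (*-monoˡ-≤ bound (≤-trans (s≤s z≤n) 7≤n)) (lemma bound (n * bound))
    where
    lemma : ∀ e t → e + t + 0 ≡ t + (e + 0)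
    lemma = solve-∀

  centre-hub-first : ∀ c v → bound ≤ specialLabel c (fsuc v) + (specialDist centre c + 1)
  centre-hub-first centre v = linear {l = 0} (slot 6 (toℕ v) * bound + 2) z≤n (lemma (slot 6 (toℕ v) * bound) bound)
    where
    lemma : ∀ x e → e + 0 + (x + 2) ≡ x + (e + 1) + 1 + 0
    lemma = solve-∀
  centre-hub-first bottom v = linear {l = 0} (slot 0 (toℕ v) * bound) z≤n (lemma (slot 0 (toℕ v) * bound) k)
    where
    lemma : ∀ x k → suc (suc k) + suc k + 2 + 0 + x ≡ x + (suc k + 2) + (suc k + 1) + 0
    lemma = solve-∀
  centre-hub-first top v = linear {l = 0} (slot 2 (toℕ v) * bound + 1) z≤n (lemma (slot 2 (toℕ v) * bound) k)
    where
    lemma : ∀ x k → suc (suc k) + suc k + 2 + 0 + (x + 1) ≡ x + (suc k + 3) + (suc k + 1) + 0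
    lemma = solve-∀

  hub-last : ∀ c v x d → x ≡ hubLabel bottom ⊎ x ≡ hubLabel top → (c ≡ centre → d ≡ suc r) →
             specialLabel c (fsuc v) + bound ≤ x + d
  hub-last c v x d late near = ≤-trans (base c near) (+-monoˡ-≤ d (later late))
    where
    later : x ≡ hubLabel bottom ⊎ x ≡ hubLabel top → hubLabel bottom ≤ x
    later (inj₁ refl) = ≤-refl
    later (inj₂ refl) = +-monoʳ-≤ (n * bound) (+-monoʳ-≤ r (s≤s (s≤s (s≤s z≤n))))
    base : ∀ c → (c ≡ centre → d ≡ suc r) → specialLabel c (fsuc v) + bound ≤ hubLabel bottom + d
    base centre near rewrite near refl =
      linear 0 (*-monoˡ-≤ bound (slot< 6 (toℕ v))) (lemma (slot 6 (toℕ v) * bound) (n * bound) k)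
      where
      lemma : ∀ x y k → x + (suc (suc k) + suc k + 2 + 1) + (suc (suc k) + suc k + 2) + y + 0
                      ≡ y + (suc k + 3) + suc (suc k) + (suc (suc k) + suc k + 2 + x)
      lemma = solve-∀
    base bottom _ =
      linear (1 + d) (*-monoˡ-≤ bound (slot< 0 (toℕ v))) (lemma (slot 0 (toℕ v) * bound) (n * bound) bound r d)
      where
      lemma : ∀ x y e r d → x + (r + 2) + e + y + (1 + d) ≡ y + (r + 3) + d + (e + x)
      lemma = solve-∀
    base top _ = linear d (*-monoˡ-≤ bound (slot< 2 (toℕ v))) (lemma (slot 2 (toℕ v) * bound) (n * bound) bound r d)
      where
      lemma : ∀ x y e r d → x + (r + 3) + e + y + d ≡ y + (r + 3) + d + (e + x)
      lemma = solve-∀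

  hub-rim : ∀ c c′ v → SpecialSpaced c fzero c′ (fsuc v)
  hub-rim centre c′ v = above (centre-hub-first c′ v)
  hub-rim bottom c′ v = below (hub-last c′ v _ _ (inj₁ refl) λ { refl → +-comm r 1 })
  hub-rim top    c′ v = below (hub-last c′ v _ _ (inj₂ refl) λ { refl → +-comm r 1 })

  specialDist-sym : ∀ c c′ → specialDist c c′ ≡ specialDist c′ c
  specialDist-sym c c′ = trans (sym (special-row-dist c c′)) (trans (∣-∣-comm (specialRow c) (specialRow c′)) (special-row-dist c′ c))

  special-sym : ∀ c h c′ h′ → SpecialSpaced c h c′ h′ → SpecialSpaced c′ h′ c h
  special-sym c h c′ h′ = spaced-sym (cong₂ _+_ (specialDist-sym c c′) (wheelDist-sym h h′))

  hub-hub : ∀ c c′ → ¬ c ≡ c′ → SpecialSpaced c fzero c′ fzero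
  hub-hub centre centre c≢c′ = ⊥-elim (c≢c′ refl)
  hub-hub bottom bottom c≢c′ = ⊥-elim (c≢c′ refl)
  hub-hub top    top    c≢c′ = ⊥-elim (c≢c′ refl)
  hub-hub centre bottom _ = above {x = 0} (≤-trans one-revolution (≤-trans (m≤m+n _ _) (m≤m+n _ _)))
  hub-hub centre top    _ = above {x = 0} (≤-trans one-revolution (≤-trans (m≤m+n _ _) (m≤m+n _ _)))
  hub-hub bottom top    _ = above (≤-reflexive (lemma (n * bound) k))
    where
    lemma : ∀ x k → x + (suc k + 3) + (suc (suc k) + suc k + 2) ≡ x + (suc k + 6) + (suc k + suc k + 0)
    lemma = solve-∀
  hub-hub bottom centre c≢c′ = special-sym centre fzero bottom fzero (hub-hub centre bottom λ ())
  hub-hub top    centre c≢c′ = special-sym centre fzero top fzero (hub-hub centre top λ ())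
  hub-hub top    bottom c≢c′ = special-sym bottom fzero top fzero (hub-hub bottom top λ ())

  revolve : ∀ {i j a d} → i < j → i * bound + a + bound ≤ j * bound + a + d
  revolve {i} {j} {a} {d} i<j = linear d (*-monoˡ-≤ bound i<j) (lemma (i * bound) (j * bound) a bound d)
    where
    lemma : ∀ x y a e d → x + a + e + y + d ≡ y + a + d + (e + x)
    lemma = solve-∀

  same-special : ∀ c v v′ → ¬ v ≡ v′ → SpecialSpaced c (fsuc v) c (fsuc v′)
  same-special c v v′ v≢v′ with <-cmp (slot (shift c) (toℕ v)) (slot (shift c) (toℕ v′))
  ... | tri< i<j _ _ = above (revolve i<j)
  ... | tri≈ _ i≡j _ = ⊥-elim (v≢v′ (toℕ-injective (slot-injective (shift c) _ _ (shift≤n c) (toℕ<n v) (toℕ<n v′) i≡j)))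
    where
    shift≤n : ∀ c → shift c ≤ n
    shift≤n centre = small 6
    shift≤n bottom = z≤n
    shift≤n top    = small 2
  ... | tri> _ _ j<i = below (revolve j<i)

  -- At equal ranks bottom comes two visits before centre; at the next rank it follows centre
  -- immediately. In all other cases the labels differ by at least `bound`.
  centre-bottom : ∀ v v′ → SpecialSpaced centre (fsuc v) bottom (fsuc v′)
  centre-bottom v v′ with <-cmp (slot 6 (toℕ v)) (slot 0 (toℕ v′))
  ... | tri≈ _ i≡j _ = below (linear 0 (≤-reflexive (cong (_* bound) (sym i≡j)) ⊹ slot₆₀-same _ _ i≡j)
                                (lemma (slot 6 (toℕ v) * bound) (slot 0 (toℕ v′) * bound) k (rimDist n (toℕ v) (toℕ v′))))
    where
    lemma : ∀ x y k d → y + (suc k + 2) + (suc (suc k) + suc k + 2) + (x + d) + 0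
                      ≡ x + (suc (suc k) + suc k + 2 + 1) + (suc k + d) + (y + 1)
    lemma = solve-∀
  ... | tri> _ _ j<i = below (linear (2 * k + 4 + rimDist n (toℕ v) (toℕ v′)) (*-monoˡ-≤ bound j<i)
                                (lemma (slot 6 (toℕ v) * bound) (slot 0 (toℕ v′) * bound) k (rimDist n (toℕ v) (toℕ v′))))
    where
    lemma : ∀ x y k d → y + (suc k + 2) + (suc (suc k) + suc k + 2) + x + (2 * k + 4 + d)
                      ≡ x + (suc (suc k) + suc k + 2 + 1) + (suc k + d) + (suc (suc k) + suc k + 2 + y)
    lemma = solve-∀
  ... | tri< i<j _ _ with m≤n⇒m<n∨m≡n i<j
  ...   | inj₁ i+2≤j = above (linear (2 * k + 3 + rimDist n (toℕ v) (toℕ v′)) (*-monoˡ-≤ bound i+2≤j)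
                                (lemma (slot 6 (toℕ v) * bound) (slot 0 (toℕ v′) * bound) k (rimDist n (toℕ v) (toℕ v′))))
    where
    lemma : ∀ x y k d → x + (suc (suc k) + suc k + 2 + 1) + (suc (suc k) + suc k + 2) + y + (2 * k + 3 + d)
                      ≡ y + (suc k + 2) + (suc k + d) + (suc (suc k) + suc k + 2 + (suc (suc k) + suc k + 2 + x))
    lemma = solve-∀
  ...   | inj₂ 1+i≡j = above (linear 0 (≤-reflexive (cong (_* bound) 1+i≡j) ⊹ ≤-reflexive (sym (slot₆₀-next _ _ (sym 1+i≡j))))
                                (lemma (slot 6 (toℕ v) * bound) (slot 0 (toℕ v′) * bound) k (rimDist n (toℕ v) (toℕ v′))))
    where
    lemma : ∀ x y k d → x + (suc (suc k) + suc k + 2 + 1) + (suc (suc k) + suc k + 2) + (y + d) + 0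
                      ≡ y + (suc k + 2) + (suc k + d) + (suc (suc k) + suc k + 2 + x + 2)
    lemma = solve-∀

  centre-top : ∀ v v′ → SpecialSpaced centre (fsuc v) top (fsuc v′)
  centre-top v v′ with <-cmp (slot 6 (toℕ v)) (slot 2 (toℕ v′))
  ... | tri≈ _ i≡j _ = below (linear 0 (≤-reflexive (cong (_* bound) (sym i≡j)) ⊹ ≤-reflexive (sym (slot₆₂-same _ _ i≡j)))
                                (lemma (slot 6 (toℕ v) * bound) (slot 2 (toℕ v′) * bound) k (rimDist n (toℕ v) (toℕ v′))))
    where
    lemma : ∀ x y k d → y + (suc k + 3) + (suc (suc k) + suc k + 2) + (x + d) + 0
                      ≡ x + (suc (suc k) + suc k + 2 + 1) + (suc k + d) + (y + 2)
    lemma = solve-∀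
  ... | tri> _ _ j<i = below (linear (2 * k + 3 + rimDist n (toℕ v) (toℕ v′)) (*-monoˡ-≤ bound j<i)
                                (lemma (slot 6 (toℕ v) * bound) (slot 2 (toℕ v′) * bound) k (rimDist n (toℕ v) (toℕ v′))))
    where
    lemma : ∀ x y k d → y + (suc k + 3) + (suc (suc k) + suc k + 2) + x + (2 * k + 3 + d)
                      ≡ x + (suc (suc k) + suc k + 2 + 1) + (suc k + d) + (suc (suc k) + suc k + 2 + y)
    lemma = solve-∀
  ... | tri< i<j _ _ with m≤n⇒m<n∨m≡n i<j
  ...   | inj₁ i+2≤j = above (linear (2 * k + 4 + rimDist n (toℕ v) (toℕ v′)) (*-monoˡ-≤ bound i+2≤j)
                                (lemma (slot 6 (toℕ v) * bound) (slot 2 (toℕ v′) * bound) k (rimDist n (toℕ v) (toℕ v′))))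
    where
    lemma : ∀ x y k d → x + (suc (suc k) + suc k + 2 + 1) + (suc (suc k) + suc k + 2) + y + (2 * k + 4 + d)
                      ≡ y + (suc k + 3) + (suc k + d) + (suc (suc k) + suc k + 2 + (suc (suc k) + suc k + 2 + x))
    lemma = solve-∀
  ...   | inj₂ 1+i≡j = above (linear 0 (≤-reflexive (cong (_* bound) 1+i≡j) ⊹ slot₆₂-next _ _ (sym 1+i≡j))
                                (lemma (slot 6 (toℕ v) * bound) (slot 2 (toℕ v′) * bound) k (rimDist n (toℕ v) (toℕ v′))))
    where
    lemma : ∀ x y k d → x + (suc (suc k) + suc k + 2 + 1) + (suc (suc k) + suc k + 2) + (y + d) + 0
                      ≡ y + (suc k + 3) + (suc k + d) + (suc (suc k) + suc k + 2 + x + 1)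
    lemma = solve-∀

  bottom-top : ∀ v v′ → SpecialSpaced bottom (fsuc v) top (fsuc v′)
  bottom-top v v′ with <-cmp (slot 0 (toℕ v)) (slot 2 (toℕ v′))
  ... | tri≈ _ i≡j _ = above (linear 0 (≤-reflexive (cong (_* bound) i≡j) ⊹ ≤-reflexive (sym (slot₀₂-same _ _ i≡j)))
                                (lemma (slot 0 (toℕ v) * bound) (slot 2 (toℕ v′) * bound) k (rimDist n (toℕ v) (toℕ v′))))
    where
    lemma : ∀ x y k d → x + (suc k + 2) + (suc (suc k) + suc k + 2) + (y + d) + 0
                      ≡ y + (suc k + 3) + (suc k + suc k + d) + (x + 2)
    lemma = solve-∀
  ... | tri< i<j _ _ = above (linear (2 * k + 3 + rimDist n (toℕ v) (toℕ v′)) (*-monoˡ-≤ bound i<j)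
                                (lemma (slot 0 (toℕ v) * bound) (slot 2 (toℕ v′) * bound) k (rimDist n (toℕ v) (toℕ v′))))
    where
    lemma : ∀ x y k d → x + (suc k + 2) + (suc (suc k) + suc k + 2) + y + (2 * k + 3 + d)
                      ≡ y + (suc k + 3) + (suc k + suc k + d) + (suc (suc k) + suc k + 2 + x)
    lemma = solve-∀
  ... | tri> _ _ j<i = below (linear (2 * k + 1 + rimDist n (toℕ v) (toℕ v′)) (*-monoˡ-≤ bound j<i)
                                (lemma (slot 0 (toℕ v) * bound) (slot 2 (toℕ v′) * bound) k (rimDist n (toℕ v) (toℕ v′))))
    where
    lemma : ∀ x y k d → y + (suc k + 3) + (suc (suc k) + suc k + 2) + x + (2 * k + 1 + d)
                      ≡ x + (suc k + 2) + (suc k + suc k + d) + (suc (suc k) + suc k + 2 + y)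
    lemma = solve-∀

  rim-rim : ∀ c v c′ v′ → ¬ (c , v) ≡ (c′ , v′) → SpecialSpaced c (fsuc v) c′ (fsuc v′)
  rim-rim centre v centre v′ u≢v = same-special centre v v′ (λ { refl → u≢v refl })
  rim-rim bottom v bottom v′ u≢v = same-special bottom v v′ (λ { refl → u≢v refl })
  rim-rim top    v top    v′ u≢v = same-special top v v′ (λ { refl → u≢v refl })
  rim-rim centre v bottom v′ _ = centre-bottom v v′
  rim-rim centre v top    v′ _ = centre-top v v′
  rim-rim bottom v top    v′ _ = bottom-top v v′
  rim-rim bottom v centre v′ _ = special-sym centre (fsuc v′) bottom (fsuc v) (centre-bottom v′ v)
  rim-rim top    v centre v′ _ = special-sym centre (fsuc v′) top (fsuc v) (centre-top v′ v)
  rim-rim top    v bottom v′ _ = special-sym bottom (fsuc v′) top (fsuc v) (bottom-top v′ v)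

  special-separated : ∀ c h c′ h′ → ¬ (c , h) ≡ (c′ , h′) → SpecialSpaced c h c′ h′
  special-separated c fzero    c′ fzero     u≢v = hub-hub c c′ (λ { refl → u≢v refl })
  special-separated c fzero    c′ (fsuc v′) _   = hub-rim c c′ v′
  special-separated c (fsuc v) c′ fzero     _   = special-sym c′ fzero c (fsuc v) (hub-rim c′ c v)
  special-separated c (fsuc v) c′ (fsuc v′) u≢v = rim-rim c v c′ v′ (λ { refl → u≢v refl })

  specialLabel-end : ∀ c h → (¬ c ≡ centre × h ≡ fzero) ⊎ specialLabel c h + bound ≤ specialPeriod
  specialLabel-end centre fzero = inj₂ (linear {l = 0} (n * bound + 5) z≤n (lemma (n * bound) bound))
    where
    lemma : ∀ x e → 0 + e + 0 + (x + 5) ≡ x + e + 5 + 0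
    lemma = solve-∀
  specialLabel-end bottom fzero = inj₁ ((λ ()) , refl)
  specialLabel-end top    fzero = inj₁ ((λ ()) , refl)
  specialLabel-end centre (fsuc v) =
    inj₂ (linear 4 (*-monoˡ-≤ bound (slot< 6 (toℕ v))) (lemma (slot 6 (toℕ v) * bound) (n * bound) bound))
    where
    lemma : ∀ x y e → x + (e + 1) + e + y + 4 ≡ y + e + 5 + (e + x)
    lemma = solve-∀
  specialLabel-end bottom (fsuc v) =
    inj₂ (linear (k + 7) (*-monoˡ-≤ bound (slot< 0 (toℕ v))) (lemma (slot 0 (toℕ v) * bound) (n * bound) k))
    where
    lemma : ∀ x y k → x + (suc k + 2) + (suc (suc k) + suc k + 2) + y + (k + 7)
              ≡ y + (suc (suc k) + suc k + 2) + 5 + (suc (suc k) + suc k + 2 + x)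
    lemma = solve-∀
  specialLabel-end top (fsuc v) =
    inj₂ (linear (k + 6) (*-monoˡ-≤ bound (slot< 2 (toℕ v))) (lemma (slot 2 (toℕ v) * bound) (n * bound) k))
    where
    lemma : ∀ x y k → x + (suc k + 3) + (suc (suc k) + suc k + 2) + y + (k + 6)
              ≡ y + (suc (suc k) + suc k + 2) + 5 + (suc (suc k) + suc k + 2 + x)
    lemma = solve-∀

  specialLabel-max : ∀ c h → specialLabel c h + suc (suc r) ≤ specialPeriod
  specialLabel-max c h with specialLabel-end c h
  ... | inj₂ end = ≤-trans (+-monoʳ-≤ (specialLabel c h) (linear {l = 0} (2 + k) z≤n (lemma k))) end
    where
    lemma : ∀ k → suc (suc (suc k)) + 0 + (2 + k) ≡ suc (suc k) + suc k + 2 + 0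
    lemma = solve-∀
  specialLabel-max centre h | inj₁ (c≢ , refl) = ⊥-elim (c≢ refl)
  specialLabel-max bottom h | inj₁ (_ , refl) = linear {l = 0} 3 z≤n (lemma (n * bound) k)
    where
    lemma : ∀ x k → x + (suc k + 3) + suc (suc (suc k)) + 0 + 3 ≡ x + (suc (suc k) + suc k + 2) + 5 + 0
    lemma = solve-∀
  specialLabel-max top h | inj₁ (_ , refl) = linear {l = 0} 0 z≤n (lemma (n * bound) k)
    where
    lemma : ∀ x k → x + (suc k + 6) + suc (suc (suc k)) + 0 + 0 ≡ x + (suc (suc k) + suc k + 2) + 5 + 0
    lemma = solve-∀

  pairLabel-start : ∀ s p h → (p ≡ 0 × (s , h) ≡ (first , fzero)) ⊎ suc (suc r) ≤ pairLabel s p h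
  pairLabel-start s zero h with blockLabel-start s h
  ... | inj₁ e = inj₁ (refl , e)
  ... | inj₂ start = inj₂ start
  pairLabel-start s (suc p) h =
    inj₂ (≤-trans (≤-trans (m≤n+m _ (blockLabel s h)) (blockLabel-max s h)) (≤-trans (m≤m+n _ _) (m≤m+n _ _)))

  -- Distance matters only between the bottom or top hub and the hub of row r - 1, where the pairs
  -- begin: it is r - 1 from the bottom and r + 1 from the top.
  special-pair : ∀ c h s p q h′ → suc (p + q) ≡ r →
    Spaced bound (specialLabel c h) (specialPeriod + pairLabel s p h′) (∣ specialRow c - row s q ∣ + wheelDist h h′)
  special-pair c h s p q h′ eq with specialLabel-end c h | pairLabel-start s p h′
  ... | inj₂ end | _ = above (≤-trans end (≤-trans (m≤m+n _ _) (m≤m+n _ _)))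
  ... | inj₁ _ | inj₂ start = above (≤-trans (linear 1 (specialLabel-max c h ⊹ start) (lemma (specialLabel c h) specialPeriod (pairLabel s p h′) k))
                                    (m≤m+n (specialPeriod + pairLabel s p h′) _))
    where
    lemma : ∀ x S P k → x + (suc (suc k) + suc k + 2) + (S + P) + 1
              ≡ S + P + (x + suc (suc (suc k)) + suc (suc (suc k)))
    lemma = solve-∀
  special-pair centre h s p q h′ eq | inj₁ (c≢ , refl) | inj₁ _ = ⊥-elim (c≢ refl)
  special-pair bottom h s p q h′ refl | inj₁ (_ , refl) | inj₁ (refl , refl) =
    above (linear {l = 0} 1 z≤n (lemma (n * bound) q))
    where
    lemma : ∀ x q → x + (suc q + 3) + (suc (suc q) + suc q + 2) + 0 + 1
              ≡ x + (suc (suc q) + suc q + 2) + 5 + 0 + (q + 0) + 0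
    lemma = solve-∀
  special-pair top h s p q h′ refl | inj₁ (_ , refl) | inj₁ (refl , refl) =
    above (linear 0 (m≤∣m-n∣+n (r + r) q) (lemma (n * bound) q ∣ r + r - q ∣))
    where
    lemma : ∀ x q d → x + (suc q + 6) + (suc (suc q) + suc q + 2) + (d + q) + 0
              ≡ x + (suc (suc q) + suc q + 2) + 5 + 0 + (d + 0) + (suc q + suc q)
    lemma = solve-∀

  -- The condition 1 ≤ q leaves out the block of the rows 0 and r, which are special.
  data Row : ℕ → Set where
    special : ∀ c → Row (specialRow c)
    pair    : ∀ s p q → suc (p + q) ≡ r → 1 ≤ q → Row (row s q)

  rowOf : ∀ i → i < 1 + 2 * r → Row i
  rowOf i i<m with i ≟ r + r
  ... | yes refl = special top
  ... | no i≢2r with pairOf i (≤∧≢⇒< (≤-trans (≤-pred i<m) (≤-reflexive (cong (r +_) (+-identityʳ r)))) i≢2r)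
  ...   | first , p , zero  , eq , refl = special bottom
  ...   | last  , p , zero  , eq , refl = subst Row (sym (+-identityʳ r)) (special centre)
  ...   | s     , p , suc q , eq , refl = pair s p (suc q) eq (s≤s z≤n)

  label : ∀ {i} → Row i → Fin (suc n) → ℕ
  label (special c)      h = specialLabel c h
  label (pair s p q _ _) h = specialPeriod + pairLabel s p h

  label-max : ∀ {i} (ρ : Row i) h → label ρ h + suc (suc r) ≤ specialPeriod + k * blockPeriod
  label-max (special c) h = ≤-trans (specialLabel-max c h) (m≤m+n _ _)
  label-max (pair s p q eq 1≤q) h = subst (_≤ specialPeriod + k * blockPeriod) (sym (+-assoc specialPeriod (pairLabel s p h) (suc (suc r))))
    (+-monoʳ-≤ specialPeriod (pairLabel-max s p h (subst (suc p ≤_) (suc-injective eq) (linear 0 1≤q (lemma p q)))))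
    where
    lemma : ∀ p q → suc p + q + 0 ≡ p + q + 1
    lemma = solve-∀

  label-separated : ∀ {i j} (ρ : Row i) (ρ′ : Row j) h h′ → ¬ (i , h) ≡ (j , h′) →
                    Spaced bound (label ρ h) (label ρ′ h′) (∣ i - j ∣ + wheelDist h h′)
  label-separated (special c) (special c′) h h′ u≢v =
    subst (λ d → Spaced bound _ _ (d + wheelDist h h′)) (sym (special-row-dist c c′)) (special-separated c h c′ h′ (λ { refl → u≢v refl }))
  label-separated (special c) (pair s p q eq _) h h′ _ = special-pair c h s p q h′ eq
  label-separated (pair s p q eq _) (special c) h h′ _ =
    spaced-sym (cong₂ _+_ (∣-∣-comm (specialRow c) (row s q)) (wheelDist-sym h′ h)) (special-pair c h′ s p q h eq)
  label-separated (pair s p q eq _) (pair s′ p′ q′ eq′ _) h h′ u≢v =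
    spaced-shift specialPeriod (pairs-separated s p q h s′ p′ q′ h′ eq eq′ u≢v)

-- The radio number for each parity of m

fin-distinct : ∀ {m} {A : Set} {i j : Fin m} {x y : A} → ¬ (i , x) ≡ (j , y) → ¬ (toℕ i , x) ≡ (toℕ j , y)
fin-distinct u≢v eq = u≢v (cong₂ _,_ (toℕ-injective (cong proj₁ eq)) (cong proj₂ eq))

radioNumber-odd : ∀ k n → 7 ≤ n →
  IsRadioNumber (Path (1 + 2 * suc k) □ Wheel n) (2 * (suc n * (suc k * suc k)) + 2 * (suc k * n) + n + 4 * suc k + 1)
radioNumber-odd k n 7≤n = isRadioNumber φ
    (radio⁺ {φ = φ} (grid-metric (1 + 2 * suc k) n) (grid-diam (2 * suc k) n 4≤n) separated) φ≤
    (λ ψ → spread-odd k n ψ 4≤n)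
  where
  open ThreeRows 7≤n k
  4≤n : 4 ≤ n
  4≤n = ≤-trans (s≤s (s≤s (s≤s (s≤s z≤n)))) 7≤n
  φ : V (Path (1 + 2 * suc k) □ Wheel n) → ℕ
  φ (i , h) = label (rowOf (toℕ i) (toℕ<n i)) h
  separated : ∀ u v → ¬ u ≡ v → 2 * suc k + 2 + 1 ≤ ∣ φ u - φ v ∣ + gridDist u v
  separated (i , h) (j , h′) u≢v = ≤-trans (≤-reflexive (lemma k))
    (Spaced.spacing (label-separated (rowOf (toℕ i) (toℕ<n i)) (rowOf (toℕ j) (toℕ<n j)) h h′ (fin-distinct u≢v)))
    where
    lemma : ∀ k → 2 * suc k + 2 + 1 ≡ suc (suc k) + suc k + 2
    lemma = solve-∀
  φ≤ : ∀ v → φ v ≤ 2 * (suc n * (suc k * suc k)) + 2 * (suc k * n) + n + 4 * suc k + 1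
  φ≤ (i , h) = linear 0 (label-max (rowOf (toℕ i) (toℕ<n i)) h) (lemma (φ (i , h)) k n)
    where
    lemma : ∀ x k n → x + (n * (suc (suc k) + suc k + 2) + (suc (suc k) + suc k + 2) + 5 + k * ((2 * n + 2) * suc (suc k) + 3)) + 0
                    ≡ 2 * (suc n * (suc k * suc k)) + 2 * (suc k * n) + n + 4 * suc k + 1 + (x + suc (suc (suc k)))
    lemma = solve-∀

radioNumber-even : ∀ k n → 1 ≤ k → 7 ≤ n →
  IsRadioNumber (Path (2 * suc k) □ Wheel n) (2 * (suc n * (suc k * suc k)) + 2 * k + 1)
radioNumber-even k n 1≤k 7≤n = isRadioNumber φ
    (radio⁺ {φ = φ} (grid-metric (2 * suc k) n) (grid-diam (k + suc (k + 0)) n 4≤n) separated) φ≤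
    (λ ψ → spread-even k n ψ 4≤n)
  where
  open Block 7≤n (suc k) (suc k) ≤-refl (s≤s 1≤k)
  4≤n : 4 ≤ n
  4≤n = ≤-trans (s≤s (s≤s (s≤s (s≤s z≤n)))) 7≤n
  data Row : ℕ → Set where
    pair : ∀ s p q → suc (p + q) ≡ suc k → Row (row s q)
  rowOf : ∀ i → i < 2 * suc k → Row i
  rowOf i i<m with pairOf i (<-≤-trans i<m (≤-reflexive (cong (suc k +_) (+-identityʳ (suc k)))))
  ... | s , p , q , eq , refl = pair s p q eq
  label : ∀ {i} → Row i → Fin (suc n) → ℕ
  label (pair s p q _) h = pairLabel s p h
  label-separated : ∀ {i j} (ρ : Row i) (ρ′ : Row j) h h′ → ¬ (i , h) ≡ (j , h′) →
                    Spaced bound (label ρ h) (label ρ′ h′) (∣ i - j ∣ + wheelDist h h′)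
  label-separated (pair s p q eq) (pair s′ p′ q′ eq′) h h′ = pairs-separated s p q h s′ p′ q′ h′ eq eq′
  label-max : ∀ {i} (ρ : Row i) h → label ρ h + suc (suc k) ≤ suc k * blockPeriod
  label-max (pair s p q eq) h = pairLabel-max s p h (≤-trans (s≤s (m≤m+n p q)) (≤-reflexive eq))
  φ : V (Path (2 * suc k) □ Wheel n) → ℕ
  φ (i , h) = label (rowOf (toℕ i) (toℕ<n i)) h
  separated : ∀ u v → ¬ u ≡ v → k + suc (k + 0) + 2 + 1 ≤ ∣ φ u - φ v ∣ + gridDist u v
  separated (i , h) (j , h′) u≢v = ≤-trans (≤-reflexive (lemma k))
    (Spaced.spacing (label-separated (rowOf (toℕ i) (toℕ<n i)) (rowOf (toℕ j) (toℕ<n j)) h h′ (fin-distinct u≢v)))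
    where
    lemma : ∀ k → k + suc (k + 0) + 2 + 1 ≡ suc k + suc k + 2
    lemma = solve-∀
  φ≤ : ∀ v → φ v ≤ 2 * (suc n * (suc k * suc k)) + 2 * k + 1
  φ≤ (i , h) = linear 0 (label-max (rowOf (toℕ i) (toℕ<n i)) h) (lemma (φ (i , h)) k n)
    where
    lemma : ∀ x k n → x + suc k * ((2 * n + 2) * suc k + 3) + 0
              ≡ 2 * (suc n * (suc k * suc k)) + 2 * k + 1 + (x + suc (suc k))
    lemma = solve-∀

-- Reduces the closed forms, with their truncated subtraction and division, to a polynomial identity
-- for the numerator.
half : ∀ {a} b c → a ≡ b * 2 + c → (a ∸ c) / 2 ≡ b
half b c refl = trans (cong (_/ 2) (m+n∸n≡m (b * 2) c)) (m*n/n≡m b 2)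

theorem3p5 : (m n : ℕ) → 3 ≤ m → 7 ≤ n →
    (m % 2 ≡ 0 → IsRadioNumber (Path m □ Wheel n) ((m * m * n + m * m + 2 * m ∸ 2) / 2))
    × (m % 2 ≡ 1 → IsRadioNumber (Path m □ Wheel n) ((m * m * n + m * m + 2 * m + n ∸ 1) / 2))
theorem3p5 m n 3≤m 7≤n = (λ r≡0 → even-case (m / 2) (decompose r≡0) 3≤m) , (λ r≡1 → odd-case (m / 2) (decompose r≡1) 3≤m)
  where
  decompose : ∀ {r} → m % 2 ≡ r → m ≡ r + 2 * (m / 2)
  decompose refl = trans (m≡m%n+[m/n]*n m 2) (cong (m % 2 +_) (*-comm (m / 2) 2))
  even-case : ∀ {m} k → m ≡ 2 * k → 3 ≤ m → IsRadioNumber (Path m □ Wheel n) ((m * m * n + m * m + 2 * m ∸ 2) / 2)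
  even-case zero refl ()
  even-case (suc zero) refl (s≤s (s≤s ()))
  even-case (suc (suc k)) refl _ = subst (IsRadioNumber _) (sym (half _ 2 (lemma (suc k) n))) (radioNumber-even (suc k) n (s≤s z≤n) 7≤n)
    where
    lemma : ∀ k n → 2 * suc k * (2 * suc k) * n + 2 * suc k * (2 * suc k) + 2 * (2 * suc k)
                  ≡ (2 * (suc n * (suc k * suc k)) + 2 * k + 1) * 2 + 2
    lemma = solve-∀
  odd-case : ∀ {m} k → m ≡ 1 + 2 * k → 3 ≤ m → IsRadioNumber (Path m □ Wheel n) ((m * m * n + m * m + 2 * m + n ∸ 1) / 2)
  odd-case zero refl (s≤s ())
  odd-case (suc k) refl _ = subst (IsRadioNumber _) (sym (half _ 1 (lemma k n))) (radioNumber-odd k n 7≤n)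
    where
    lemma : ∀ k n → (1 + 2 * suc k) * (1 + 2 * suc k) * n + (1 + 2 * suc k) * (1 + 2 * suc k) + 2 * (1 + 2 * suc k) + n
                  ≡ (2 * (suc n * (suc k * suc k)) + 2 * (suc k * n) + n + 4 * suc k + 1) * 2 + 1
    lemma = solve-∀
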